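{- Let $G$ be a finite non-cyclic nilpotent group. Then the proper enhanced power graph $\mathcal{E}^{**}(G)$ is claw-free if and only if there exist a prime $p$, a non-cyclic finite $p$-group $P$ and a positive integer $n$ such that: (i) $G\cong P\times C_n$ and $\gcd(|P|,n)=1$; (ii) $\mathcal{E}^{**}(P)$ is claw-free.
   Context: For a finite group $G$, the enhanced power graph $\mathcal{E}(G)$ is the graph with vertex set $G$ in which two distinct vertices $u,v$ are adjacent if and only if $\langle u,v\rangle$ is cyclic. A vertex is dominating if it is adjacent to all other vertices. The proper enhanced power graph $\mathcal{E}^{**}(G)$ is the subgraph of $\mathcal{E}(G)$ induced on the non-dominating vertices. A graph is claw-free if it has no induced subgraph isomorphic to $K_{1,3}$. $C_n$ denotes the cyclic group of order $n$. -}

module Defs where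

open import Algebra.Bundles using (Group)
open import Algebra.Morphism.Structures using (IsGroupIsomorphism)
open import Data.Fin.Base using (Fin; toℕ)
open import Data.Fin.Properties using (toℕ-injective; toℕ-fromℕ<; toℕ<n)
open import Data.Nat.Base using (ℕ; zero; suc; _+_; _∸_; _^_; NonZero)
open import Data.Nat.DivMod using (_%_; _mod_; m%n<n; m<n⇒m%n≡m; n%n≡0; %-distribˡ-+; m%n%n≡m%n)
open import Data.Nat.Properties using (+-assoc; +-comm; m+[n∸m]≡n; <⇒≤)
open import Data.Product.Base using (Σ; ∃; _×_; _,_; proj₁; proj₂)
open import Data.Sum.Base using (_⊎_; inj₁; inj₂)
open import Function.Base using (_∘_; _on_)
open import Function.Bundles using (Inverse; _⇔_)
open import Function.Construct.Identity using () renaming (inverse to id-inverse)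
open import Level using (Level; _⊔_; 0ℓ) renaming (suc to lsuc)
open import Relation.Binary.Bundles using (Setoid)
open import Relation.Binary.Core using (Rel)
open import Relation.Binary.Definitions using (Symmetric; Irreflexive; _Respects₂_)
import Relation.Binary.Construct.On as On
open import Relation.Binary.PropositionalEquality using (_≡_; refl; sym; trans; cong; cong₂; setoid; isEquivalence; module ≡-Reasoning)
open import Relation.Nullary using (¬_)
open import Relation.Unary using (Pred; _∈_; _∪_; ｛_｝; _≐_)
open import Relation.Unary.Polymorphic using (U)

private
  variable
    a b c v e r v′ e′ r′ p ℓ ℓ′ : Level

------------------------------------------------------------------------
-- Simple graphs

record SimpleGraph (v e r : Level) : Set (lsuc (v ⊔ e ⊔ r)) where
  infix 4 _~_
  field
    vertices : Setoid v e
  open Setoid vertices public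
    using (_≈_; _≉_) renaming (Carrier to Vertex)
  field
    _~_      : Rel Vertex r
    ~-sym    : Symmetric _~_
    ~-irrefl : Irreflexive _≈_ _~_
    ~-resp-≈ : _~_ Respects₂ _≈_

  Dominating : Pred Vertex (v ⊔ e ⊔ r)
  Dominating x = ∀ y → x ≉ y → x ~ y

induced : (Γ : SimpleGraph v e r) → Pred (SimpleGraph.Vertex Γ) p →
          SimpleGraph (v ⊔ p) e r
induced Γ S = record
  { vertices = On.setoid {B = Σ Vertex S} vertices proj₁
  ; _~_      = _~_ on proj₁
  ; ~-sym    = ~-sym
  ; ~-irrefl = ~-irrefl
  ; ~-resp-≈ = proj₁ ~-resp-≈ , proj₂ ~-resp-≈
  }
  where open SimpleGraph Γ

record _≅_ (Γ : SimpleGraph v e r) (Δ : SimpleGraph v′ e′ r′)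
         : Set (v ⊔ e ⊔ r ⊔ v′ ⊔ e′ ⊔ r′) where
  private
    module Γ = SimpleGraph Γ
    module Δ = SimpleGraph Δ
  field
    bijection : Inverse Γ.vertices Δ.vertices
  open Inverse bijection public using (to)
  field
    adjacency : ∀ x y → (x Γ.~ y) ⇔ (to x Δ.~ to y)

data BipartiteAdj (m n : ℕ) : Rel (Fin m ⊎ Fin n) 0ℓ where
  left-right : ∀ i j → BipartiteAdj m n (inj₁ i) (inj₂ j)
  right-left : ∀ i j → BipartiteAdj m n (inj₂ j) (inj₁ i)

K : ℕ → ℕ → SimpleGraph 0ℓ 0ℓ 0ℓ
K m n = record
  { vertices = setoid (Fin m ⊎ Fin n)
  ; _~_      = BipartiteAdj m n
  ; ~-sym    = λ { (left-right i j) → right-left i j ; (right-left i j) → left-right i j }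
  ; ~-irrefl = λ { refl () }
  ; ~-resp-≈ = (λ { refl x~y → x~y }) , (λ { refl x~y → x~y })
  }

-- Vertex sets range over the level of the vertex equality; this loses no
-- induced copy of K 1 3, since a finite set of vertices {x₁, …, xₖ} is
-- the predicate "equal to some xᵢ", which lives at that level.
ClawFree : SimpleGraph v e r → Set (v ⊔ lsuc e ⊔ r)
ClawFree {e = e} Γ = (S : Pred (SimpleGraph.Vertex Γ) e) → ¬ (induced Γ S ≅ K 1 3)

------------------------------------------------------------------------
-- Groups

module _ (G : Group c ℓ) where
  open Group G renaming (refl to ≈-refl; sym to ≈-sym; trans to ≈-trans)

  -- The stdlib singleton ｛ x ｝ is up to ≡; closing under ≈ makes ⟨ ｛ x ｝ ⟩
  -- the subgroup generated by the ≈-class of x.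
  data ⟨_⟩ (S : Pred Carrier p) : Pred Carrier (c ⊔ ℓ ⊔ p) where
    gen  : ∀ {x} → x ∈ S → x ∈ ⟨_⟩ S
    one  : ε ∈ ⟨_⟩ S
    mul  : ∀ {x y} → x ∈ ⟨_⟩ S → y ∈ ⟨_⟩ S → x ∙ y ∈ ⟨_⟩ S
    inv  : ∀ {x} → x ∈ ⟨_⟩ S → x ⁻¹ ∈ ⟨_⟩ S
    resp : ∀ {x y} → x ≈ y → x ∈ ⟨_⟩ S → y ∈ ⟨_⟩ S

  IsCyclicSubgroup : Pred Carrier p → Set (c ⊔ ℓ ⊔ p)
  IsCyclicSubgroup H = ∃ λ g → H ≐ ⟨_⟩ ｛ g ｝

  IsCyclic : Set (c ⊔ ℓ)
  IsCyclic = IsCyclicSubgroup {p = 0ℓ} U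

  lowerCentral : ℕ → Pred Carrier (c ⊔ ℓ)
  lowerCentral zero    = U
  lowerCentral (suc i) = ⟨_⟩ λ z →
    ∃ λ x → ∃ λ y → x ∈ lowerCentral i × z ≈ x ⁻¹ ∙ y ⁻¹ ∙ x ∙ y

  IsNilpotent : Set (c ⊔ ℓ)
  IsNilpotent = ∃ λ k → ∀ {x} → x ∈ lowerCentral k → x ≈ ε

  GenerateCyclic : Rel Carrier (c ⊔ ℓ)
  GenerateCyclic x y = IsCyclicSubgroup (⟨_⟩ (｛ x ｝ ∪ ｛ y ｝))

  private
    bind : ∀ {S : Pred Carrier a} {T : Pred Carrier b} →
           (∀ {x} → x ∈ S → x ∈ ⟨_⟩ T) → ∀ {x} → x ∈ ⟨_⟩ S → x ∈ ⟨_⟩ T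
    bind f (gen s)    = f s
    bind f one        = one
    bind f (mul s t)  = mul (bind f s) (bind f t)
    bind f (inv s)    = inv (bind f s)
    bind f (resp q s) = resp q (bind f s)

    pair-⊆ : ∀ {x y} {T : Pred Carrier a} → x ∈ ⟨_⟩ T → y ∈ ⟨_⟩ T →
             ∀ {z} → z ∈ ⟨_⟩ (｛ x ｝ ∪ ｛ y ｝) → z ∈ ⟨_⟩ T
    pair-⊆ x∈ y∈ = bind λ { (inj₁ refl) → x∈ ; (inj₂ refl) → y∈ }

    fst∈ : ∀ {x y} → x ∈ ⟨_⟩ (｛ x ｝ ∪ ｛ y ｝)
    fst∈ = gen (inj₁ refl)

    snd∈ : ∀ {x y} → y ∈ ⟨_⟩ (｛ x ｝ ∪ ｛ y ｝)
    snd∈ = gen (inj₂ refl)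

    cyclic-swap : ∀ {x y} → GenerateCyclic x y → GenerateCyclic y x
    cyclic-swap (g , ⊆g , g⊆) =
      g , ⊆g ∘ pair-⊆ snd∈ fst∈ , pair-⊆ snd∈ fst∈ ∘ g⊆

    cyclic-respʳ : ∀ {x y z} → y ≈ z → GenerateCyclic x y → GenerateCyclic x z
    cyclic-respʳ y≈z (g , ⊆g , g⊆) =
      g , ⊆g ∘ pair-⊆ fst∈ (resp y≈z snd∈)
        , pair-⊆ fst∈ (resp (≈-sym y≈z) snd∈) ∘ g⊆

  enhancedPowerGraph : SimpleGraph c ℓ (c ⊔ ℓ)
  enhancedPowerGraph = record
    { vertices = Group.setoid G
    ; _~_      = λ x y → x ≉ y × GenerateCyclic x y
    ; ~-sym    = λ { (x≉y , cyc) → x≉y ∘ ≈-sym , cyclic-swap cyc }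
    ; ~-irrefl = λ { x≈y (x≉y , _) → x≉y x≈y }
    ; ~-resp-≈ =
        (λ { y≈z (x≉y , cyc) →
             (λ x≈z → x≉y (≈-trans x≈z (≈-sym y≈z))) , cyclic-respʳ y≈z cyc })
      , (λ { y≈z (y≉x , cyc) →
             (λ z≈x → y≉x (≈-trans y≈z z≈x))
           , cyclic-swap (cyclic-respʳ y≈z (cyclic-swap cyc)) })
    }

  properEnhancedPowerGraph : SimpleGraph (c ⊔ ℓ) ℓ (c ⊔ ℓ)
  properEnhancedPowerGraph =
    induced enhancedPowerGraph (λ x → ¬ SimpleGraph.Dominating enhancedPowerGraph x)

_≅ᴳ_ : Group a ℓ → Group b ℓ′ → Set (a ⊔ ℓ ⊔ b ⊔ ℓ′)
G ≅ᴳ H = ∃ (IsGroupIsomorphism (Group.rawGroup G) (Group.rawGroup H))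

------------------------------------------------------------------------
-- Finite groups

record FiniteGroup (c ℓ : Level) : Set (lsuc (c ⊔ ℓ)) where
  field
    group       : Group c ℓ
    order       : ℕ
    enumeration : Inverse (Group.setoid group) (setoid (Fin order))

open FiniteGroup public using (group; order)

IsPGroup : ℕ → FiniteGroup c ℓ → Set
IsPGroup p P = ∃ λ k → order P ≡ p ^ k

-- The integers modulo n.
module _ (n : ℕ) .{{_ : NonZero n}} where
  private
    infixl 6 _⊕_
    _⊕_ : Fin n → Fin n → Fin n
    x ⊕ y = (toℕ x + toℕ y) mod n

    ⊖_ : Fin n → Fin n
    ⊖ x = (n ∸ toℕ x) mod n

    toℕ-mod : ∀ m → toℕ (m mod n) ≡ m % n
    toℕ-mod m = toℕ-fromℕ< (m%n<n m n)

    toℕ-% : ∀ (x : Fin n) → toℕ x % n ≡ toℕ x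
    toℕ-% x = m<n⇒m%n≡m (toℕ<n x)

    mod-cong : ∀ {i j} → i % n ≡ j % n → i mod n ≡ j mod n
    mod-cong {i} {j} eq = toℕ-injective (trans (toℕ-mod i) (trans eq (sym (toℕ-mod j))))

    mod-toℕ : ∀ x → toℕ x mod n ≡ x
    mod-toℕ x = toℕ-injective (trans (toℕ-mod (toℕ x)) (toℕ-% x))

    %-+ˡ : ∀ i j → (i % n + j) % n ≡ (i + j) % n
    %-+ˡ i j = begin
      (i % n + j) % n          ≡⟨ %-distribˡ-+ (i % n) j n ⟩
      (i % n % n + j % n) % n  ≡⟨ cong (λ k → (k + j % n) % n) (m%n%n≡m%n i n) ⟩
      (i % n + j % n) % n      ≡⟨ %-distribˡ-+ i j n ⟨
      (i + j) % n              ∎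
      where open ≡-Reasoning

    mod-⊕ : ∀ i y → (i mod n) ⊕ y ≡ (i + toℕ y) mod n
    mod-⊕ i y = mod-cong (trans (cong (λ k → (k + toℕ y) % n) (toℕ-mod i)) (%-+ˡ i (toℕ y)))

    ⊕-comm : ∀ x y → x ⊕ y ≡ y ⊕ x
    ⊕-comm x y = cong (_mod n) (+-comm (toℕ x) (toℕ y))

    ⊕-assoc : ∀ x y z → (x ⊕ y) ⊕ z ≡ x ⊕ (y ⊕ z)
    ⊕-assoc x y z = begin
      (x ⊕ y) ⊕ z                    ≡⟨ mod-⊕ (toℕ x + toℕ y) z ⟩
      (toℕ x + toℕ y + toℕ z) mod n  ≡⟨ cong (_mod n) (trans (+-assoc (toℕ x) (toℕ y) (toℕ z)) (+-comm (toℕ x) (toℕ y + toℕ z))) ⟩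
      (toℕ y + toℕ z + toℕ x) mod n  ≡⟨ mod-⊕ (toℕ y + toℕ z) x ⟨
      (y ⊕ z) ⊕ x                    ≡⟨ ⊕-comm (y ⊕ z) x ⟩
      x ⊕ (y ⊕ z)                    ∎
      where open ≡-Reasoning

    ⊕-identityˡ : ∀ x → (0 mod n) ⊕ x ≡ x
    ⊕-identityˡ x = trans (mod-⊕ 0 x) (mod-toℕ x)

    ⊕-inverseˡ : ∀ x → (⊖ x) ⊕ x ≡ 0 mod n
    ⊕-inverseˡ x = begin
      (⊖ x) ⊕ x                  ≡⟨ mod-⊕ (n ∸ toℕ x) x ⟩
      (n ∸ toℕ x + toℕ x) mod n  ≡⟨ cong (_mod n) (trans (+-comm (n ∸ toℕ x) (toℕ x)) (m+[n∸m]≡n (<⇒≤ (toℕ<n x)))) ⟩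
      n mod n                    ≡⟨ mod-cong (trans (n%n≡0 n) (sym (trans (cong (_% n) (sym (n%n≡0 n))) (trans (m%n%n≡m%n n n) (n%n≡0 n))))) ⟩
      0 mod n                    ∎
      where open ≡-Reasoning

  C : FiniteGroup 0ℓ 0ℓ
  C = record
    { group = record
      { Carrier = Fin n
      ; _≈_     = _≡_
      ; _∙_     = _⊕_
      ; ε       = 0 mod n
      ; _⁻¹     = ⊖_
      ; isGroup = record
        { isMonoid = record
          { isSemigroup = record
            { isMagma = record { isEquivalence = isEquivalence ; ∙-cong = cong₂ _⊕_ }
            ; assoc   = ⊕-assoc
            }
          ; identity = ⊕-identityˡ , λ x → trans (⊕-comm x _) (⊕-identityˡ x)
          }
        ; inverse = ⊕-inverseˡ , λ x → trans (⊕-comm x _) (⊕-inverseˡ x)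
        ; ⁻¹-cong = cong ⊖_
        }
      }
    ; order       = n
    ; enumeration = id-inverse (setoid (Fin n))
    }

{-# OPTIONS --safe #-}
module Submission where

-- Write T_m for the m-torsion of the finite nilpotent group G, for a coprime
-- factorisation |G| = m n. A subgroup of T_m that no m-torsion element outside
-- it normalises has a self-normalising normaliser, so it is normal and is all
-- of T_m. Hence T_m is a subgroup, T_m and T_n commute, and suitable powers
-- x ↦ xᵉ, x ↦ xᶠ are the projections of G = T_m × T_n.
--
-- If a, b do not generate a cyclic group, neither do any two of a, b, ab. So
-- if T_m and T_n are both non-cyclic, these three leaves from T_m and a suitable
-- centre from T_n form a claw. Since G is non-cyclic some T_q, q = pᵛ the full
-- power of p in |G|, is non-cyclic; claw-freeness makes its complement cyclic.
-- For G = P × C_n with gcd(|P|, n) = 1, two elements generate a cyclic group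
-- exactly when their P-components do, so claws transfer both ways.

open import Defs
open import Algebra.Bundles using (Group)
open import Algebra.Construct.DirectProduct using () renaming (group to _×ᴳ_)
import Algebra.Morphism.GroupMonomorphism as GroupMonomorphism
open import Algebra.Morphism.Structures using (IsGroupHomomorphism; IsGroupMonomorphism; IsGroupIsomorphism)
open import Data.Empty using (⊥; ⊥-elim)
open import Data.Fin.Base using (Fin; zero; suc; toℕ; fromℕ<; combine; remQuot)
open import Data.Fin.Properties as Fin using (toℕ-injective; toℕ-fromℕ<; toℕ<n; any?; pigeonhole; injective⇒≤; remQuot-combine; combine-remQuot; nonZeroIndex)
open import Data.List.Base using ([]; _∷_)
open import Data.List.Relation.Unary.All using (_∷_)
open import Data.Nat.Base hiding (_^_; _⊔_)
import Data.Nat.Base as ℕ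
open import Data.Nat.Coprimality as Coprimality using (Coprime; coprime-divisor; coprime-Bézout; 1-coprimeTo; coprime⇒gcd≡1; gcd≡1⇒coprime)
open import Data.Nat.DivMod using (_%_; _/_; _mod_; m≡m%n+[m/n]*n; m%n<n; m<n⇒m%n≡m; %-distribˡ-+)
open import Data.Nat.Divisibility
open import Data.Nat.GCD using (gcd; gcd-GCD; gcd[m,n]∣m; gcd[m,n]∣n; module Bézout)
open import Data.Nat.Induction using (<-rec)
open import Data.Nat.Primality using (Prime; prime⇒irreducible; prime⇒nonTrivial; prime⇒nonZero)
open import Data.Nat.Primality.Factorisation using (factorise)
open import Data.Nat.Properties hiding (_≟_)
open import Data.Nat.Tactic.RingSolver using (solve-∀)
open import Data.Product.Base hiding (map₁)
open import Data.Sum.Base using (_⊎_; inj₁; inj₂; map₁)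
open import Data.Sum.Properties using (inj₂-injective)
open import Data.Vec.Functional using () renaming (_∷_ to infixr 5 _∷ᶠ_)
open import Function.Base using (_∘_)
open import Function.Bundles using (Inverse; _⇔_; mk⇔; Equivalence)
open import Level using (_⊔_)
open import Relation.Binary.Bundles using (Setoid)
open import Relation.Binary.Core using (_Preserves_⟶_)
open import Relation.Binary.PropositionalEquality as ≡ using (_≡_; cong; cong₂; subst)
open import Relation.Nullary
open import Relation.Nullary.Decidable using (_×-dec_; map′; ¬?; decidable-stable)
open import Relation.Unary using (Pred; Decidable; ｛_｝; _∪_)

-- Arithmetic

leastPositive : ∀ {p} {P : Pred ℕ p} → Decidable P → ∀ m → 0 < m → P m →
                ∃ λ d → 0 < d × P d × (∀ k → 0 < k → k < d → ¬ P k)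
leastPositive {P = P} P? = <-rec _ step
  where
  step : ∀ m → (∀ {k} → k < m → 0 < k → P k → _) → 0 < m → P m → _
  step m rec 0<m pm with anyUpTo? (λ k → (0 <? k) ×-dec P? k) m
  ... | yes (k , k<m , 0<k , pk) = rec k<m 0<k pk
  ... | no ∄ = m , 0<m , pm , λ k 0<k k<m pk → ∄ (k , k<m , 0<k , pk)

-- A common divisor of `m * m′` and `n` is coprime to `m`, as it divides `n`; Gauss's lemma then
-- makes it divide `m′`.
coprime-*ˡ : ∀ {m m′ n} → Coprime m n → Coprime m′ n → Coprime (m * m′) n
coprime-*ˡ c c′ (d∣mm′ , d∣n) =
  c′ (coprime-divisor (λ (e∣d , e∣m) → c (e∣m , ∣-trans e∣d d∣n)) d∣mm′ , d∣n)

coprime-^ˡ : ∀ {m n} k → Coprime m n → Coprime (m ℕ.^ k) n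
coprime-^ˡ zero    _ = 1-coprimeTo _
coprime-^ˡ (suc k) c = coprime-*ˡ c (coprime-^ˡ k c)

prime∤⇒coprime : ∀ {p n} → Prime p → ¬ p ∣ n → Coprime p n
prime∤⇒coprime pr p∤n (d∣p , d∣n) with prime⇒irreducible pr d∣p
... | inj₁ d≡1 = d≡1
... | inj₂ d≡p = ⊥-elim (p∤n (subst (_∣ _) d≡p d∣n))

-- Either `p` does not divide `d`, and Gauss's lemma removes one factor `p` from the power, or one
-- `p` cancels from both sides.
∣-prime-power : ∀ {p d} k → Prime p → d ∣ p ℕ.^ k → ∃ λ j → d ≡ p ℕ.^ j
∣-prime-power         zero    pr d∣ = 0 , ∣1⇒≡1 d∣
∣-prime-power {p} {d} (suc k) pr d∣ with p ∣? d
... | no p∤d = ∣-prime-power k pr (coprime-divisor (Coprimality.sym (prime∤⇒coprime pr p∤d)) d∣)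
... | yes (divides q ≡.refl) with ∣-prime-power {d = q} k pr
        (*-cancelˡ-∣ p {{prime⇒nonZero pr}} (subst (_∣ p ℕ.^ suc k) (*-comm q p) d∣))
...   | j , q≡ = suc j , ≡.trans (*-comm q p) (cong (p *_) q≡)

primeDivisor : ∀ n .{{_ : NonZero n}} → ¬ n ≡ 1 → ∃ λ p → Prime p × p ∣ n
primeDivisor n n≢1 with factorise n
... | record { factors = []     ; isFactorisation = eq } = ⊥-elim (n≢1 eq)
... | record { factors = p ∷ ps ; isFactorisation = eq ; factorsPrime = pr ∷ _ } =
  p , pr , subst (p ∣_) (≡.sym eq) (m∣m*n _)

primePart : ∀ {p} → Prime p → ∀ n .{{_ : NonZero n}} →
            ∃₂ λ a n′ → n ≡ p ℕ.^ a * n′ × ¬ p ∣ n′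
primePart {p} pr n = <-rec (λ n → NonZero n → Split n) step n (>-nonZero (>-nonZero⁻¹ n))
  where
  Split : ℕ → Set
  Split n = ∃₂ λ a n′ → n ≡ p ℕ.^ a * n′ × ¬ p ∣ n′

  step : ∀ n → (∀ {k} → k < n → NonZero k → Split k) → NonZero n → Split n
  step n rec n≢0 with p ∣? n
  ... | no p∤n = 0 , n , ≡.sym (*-identityˡ n) , p∤n
  ... | yes (divides q ≡.refl) with rec (m<m*n q p {{q≢0}} (nonTrivial⇒n>1 p {{prime⇒nonTrivial pr}})) q≢0
    where q≢0 = m*n≢0⇒m≢0 q {{n≢0}}
  ...   | a , n′ , eq , p∤n′ = suc a , n′
          , ≡.trans (*-comm q p) (≡.trans (cong (p *_) eq) (≡.sym (*-assoc p (p ℕ.^ a) n′))) , p∤n′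

-- The exponents project a group of exponent m n onto its m- and n-torsion.
record Idempotents (m n : ℕ) : Set where
  field
    e f k : ℕ
    e+f≡1 : e + f ≡ 1 + k * (m * n)
    n∣e   : n ∣ e
    m∣f   : m ∣ f

private
  -- Modulo `m * n` the exponents should be `y * n` and `-(x * m)`. As exponents are natural
  -- numbers, `-1` is represented by `k = m * n - 1`.
  bézout-idempotents : ∀ x y m n k → 1 + x * m ≡ y * n → m * n ≡ suc k →
                       y * n + x * m * k ≡ 1 + (x * m) * (m * n)
  bézout-idempotents x y m n k eq eq′ = begin
    y * n + x * m * k          ≡⟨ cong (_+ x * m * k) eq ⟨
    1 + x * m + x * m * k      ≡⟨ lemma (x * m) k ⟩
    1 + x * m * suc k          ≡⟨ cong (λ t → 1 + x * m * t) eq′ ⟨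
    1 + (x * m) * (m * n)      ∎
    where
    open ≡.≡-Reasoning
    lemma : ∀ a b → 1 + a + a * b ≡ 1 + a * suc b
    lemma = solve-∀

abstract
  idempotents : ∀ {m n} .{{_ : NonZero (m * n)}} → Coprime m n → Idempotents m n
  idempotents {m} {n} c with m * n in eq | coprime-Bézout c
  ... | suc k | Bézout.-+ x y eq′ = record
    { e = y * n ; f = x * m * k ; k = x * m
    ; e+f≡1 = bézout-idempotents x y m n k eq′ eq
    ; n∣e = n∣m*n y ; m∣f = ∣m⇒∣m*n k (n∣m*n x) }
  ... | suc k | Bézout.+- x y eq′ = record
    { e = y * n * k ; f = x * m ; k = y * n
    ; e+f≡1 = ≡.trans (+-comm (y * n * k) (x * m))
        (≡.trans (bézout-idempotents y x n m k eq′ (≡.trans (*-comm n m) eq))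
                 (cong (λ t → 1 + y * n * t) (*-comm n m)))
    ; n∣e = ∣m⇒∣m*n k (n∣m*n y) ; m∣f = n∣m*n x }

-- Powers and pairs of powers in a group

module Powers {c ℓ} (G : Group c ℓ) where
  open Group G
  open import Algebra.Properties.Monoid.Mult monoid using (×-congʳ; ×-homo-+; ×-assocˡ)
    renaming (_×_ to _·_)
  open import Relation.Binary.Reasoning.Setoid setoid

  infixr 8 _^_
  _^_ : Carrier → ℕ → Carrier
  x ^ n = n · x

  ^-congˡ : ∀ n {x y} → x ≈ y → x ^ n ≈ y ^ n
  ^-congˡ n = ×-congʳ n

  ^-congʳ : ∀ x {m n} → m ≡ n → x ^ m ≈ x ^ n
  ^-congʳ x ≡.refl = refl

  ^-+ : ∀ x m n → x ^ (m + n) ≈ x ^ m ∙ x ^ n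
  ^-+ = ×-homo-+

  ^-* : ∀ x m n → x ^ (m * n) ≈ (x ^ m) ^ n
  ^-* x m n = trans (^-congʳ x (*-comm m n)) (sym (×-assocˡ x n m))

  ^-swap : ∀ x m n → (x ^ m) ^ n ≈ (x ^ n) ^ m
  ^-swap x m n = trans (sym (^-* x m n)) (trans (^-congʳ x (*-comm m n)) (^-* x n m))

  ε^ : ∀ n → ε ^ n ≈ ε
  ε^ zero    = refl
  ε^ (suc n) = trans (identityˡ _) (ε^ n)

  ^1 : ∀ x → x ^ 1 ≈ x
  ^1 = identityʳ

  ^≈ε-∣ : ∀ {x m n} → x ^ m ≈ ε → m ∣ n → x ^ n ≈ ε
  ^≈ε-∣ {x} {m} xᵐ≈ε (divides q ≡.refl) = begin
    x ^ (q * m)  ≈⟨ trans (^-* x q m) (^-swap x q m) ⟩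
    (x ^ m) ^ q  ≈⟨ ^-congˡ q xᵐ≈ε ⟩
    ε ^ q        ≈⟨ ε^ q ⟩
    ε            ∎

  ^≈ε-^ : ∀ {x m} k → x ^ m ≈ ε → (x ^ k) ^ m ≈ ε
  ^≈ε-^ {x} {m} k xᵐ≈ε = trans (^-swap x k m) (trans (^-congˡ k xᵐ≈ε) (ε^ k))

  ^-≡1 : ∀ {x m} k → x ^ m ≈ ε → x ^ (1 + k * m) ≈ x
  ^-≡1 {x} {m} k xᵐ≈ε = trans (∙-congˡ (^≈ε-∣ xᵐ≈ε (n∣m*n k))) (identityʳ x)

  -- Bézout: if `1 + b n = a m`, then `x` equals its power to the left side, which is trivial as a
  -- power to the right side.
  ^-coprime : ∀ {x m n} → Coprime m n → x ^ m ≈ ε → x ^ n ≈ ε → x ≈ ε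
  ^-coprime {x} {m} {n} cop xᵐ xⁿ with coprime-Bézout cop
  ... | Bézout.+- a b eq = trans (sym (^-≡1 b xⁿ)) (trans (^-congʳ x eq) (^≈ε-∣ xᵐ (n∣m*n a)))
  ... | Bézout.-+ a b eq = trans (sym (^-≡1 a xᵐ)) (trans (^-congʳ x eq) (^≈ε-∣ xⁿ (n∣m*n b)))

  module _ {m n} (idem : Idempotents m n) where
    open Idempotents idem

    ^-e-fix : ∀ {x} → x ^ m ≈ ε → x ^ e ≈ x
    ^-e-fix {x} xm = trans (sym (trans (∙-congˡ (^≈ε-∣ xm m∣f)) (identityʳ _)))
      (trans (sym (^-+ x e f)) (trans (^-congʳ x e+f≡1) (^-≡1 {m = m * n} k (^≈ε-∣ {m = m} xm (m∣m*n n)))))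

    ^-f-fix : ∀ {x} → x ^ n ≈ ε → x ^ f ≈ x
    ^-f-fix {x} xn = trans (sym (trans (∙-congʳ (^≈ε-∣ xn n∣e)) (identityˡ _)))
      (trans (sym (^-+ x e f)) (trans (^-congʳ x e+f≡1) (^-≡1 {m = m * n} k (^≈ε-∣ {m = n} xn (n∣m*n m)))))

    -- Chinese remainder theorem: `e * i + f * j` is congruent to `i` modulo `m` and to `j` modulo
    -- `n`, so one exponent prescribes the powers on both torsion parts.
    ^-crtˡ : ∀ {x} i j → x ^ m ≈ ε → x ^ (e * i + f * j) ≈ x ^ i
    ^-crtˡ {x} i j xm = trans (^-+ x (e * i) (f * j)) (trans
      (∙-cong (trans (^-* x e i) (^-congˡ i (^-e-fix xm))) (^≈ε-∣ xm (∣m⇒∣m*n j m∣f))) (identityʳ _))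

    ^-crtʳ : ∀ {x} i j → x ^ n ≈ ε → x ^ (e * i + f * j) ≈ x ^ j
    ^-crtʳ {x} i j xn = trans (^-+ x (e * i) (f * j)) (trans
      (∙-cong (^≈ε-∣ xn (∣m⇒∣m*n i n∣e)) (trans (^-* x f j) (^-congˡ j (^-f-fix xn)))) (identityˡ _))

  commute-^ʳ : ∀ {x y} n → x ∙ y ≈ y ∙ x → x ∙ y ^ n ≈ y ^ n ∙ x
  commute-^ʳ         zero    xy = trans (identityʳ _) (sym (identityˡ _))
  commute-^ʳ {x} {y} (suc n) xy = begin
    x ∙ (y ∙ y ^ n)  ≈⟨ assoc _ _ _ ⟨
    x ∙ y ∙ y ^ n    ≈⟨ ∙-congʳ xy ⟩
    y ∙ x ∙ y ^ n    ≈⟨ assoc _ _ _ ⟩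
    y ∙ (x ∙ y ^ n)  ≈⟨ ∙-congˡ (commute-^ʳ n xy) ⟩
    y ∙ (y ^ n ∙ x)  ≈⟨ assoc _ _ _ ⟨
    y ∙ y ^ n ∙ x    ∎

  interchange : ∀ {x y} w z → x ∙ y ≈ y ∙ x → (w ∙ x) ∙ (y ∙ z) ≈ (w ∙ y) ∙ (x ∙ z)
  interchange {x} {y} w z xy = begin
    (w ∙ x) ∙ (y ∙ z)  ≈⟨ assoc _ _ _ ⟩
    w ∙ (x ∙ (y ∙ z))  ≈⟨ ∙-congˡ (assoc _ _ _) ⟨
    w ∙ (x ∙ y ∙ z)    ≈⟨ ∙-congˡ (∙-congʳ xy) ⟩
    w ∙ (y ∙ x ∙ z)    ≈⟨ ∙-congˡ (assoc _ _ _) ⟩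
    w ∙ (y ∙ (x ∙ z))  ≈⟨ assoc _ _ _ ⟨
    (w ∙ y) ∙ (x ∙ z)  ∎

  ∙-^ : ∀ {x y} n → x ∙ y ≈ y ∙ x → (x ∙ y) ^ n ≈ x ^ n ∙ y ^ n
  ∙-^         zero    xy = sym (identityˡ ε)
  ∙-^ {x} {y} (suc n) xy = trans (∙-congˡ (∙-^ n xy))
    (interchange x (y ^ n) (sym (commute-^ˡ n xy)))
    where
    commute-^ˡ : ∀ n → x ∙ y ≈ y ∙ x → x ^ n ∙ y ≈ y ∙ x ^ n
    commute-^ˡ n xy = sym (commute-^ʳ n (sym xy))

  conj : Carrier → Carrier → Carrier
  conj g x = g ∙ x ∙ g ⁻¹

  conj-cong : ∀ g {x y} → x ≈ y → conj g x ≈ conj g y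
  conj-cong g x≈y = ∙-congʳ (∙-congˡ x≈y)

  conj-move : ∀ g x → conj g x ∙ g ≈ g ∙ x
  conj-move g x = trans (assoc _ _ _) (trans (∙-congˡ (inverseˡ g)) (identityʳ _))

  conj-ε : ∀ g → conj g ε ≈ ε
  conj-ε g = trans (∙-congʳ (identityʳ g)) (inverseʳ g)

  conj-∙ : ∀ g x y → conj g (x ∙ y) ≈ conj g x ∙ conj g y
  conj-∙ g x y = begin
    g ∙ (x ∙ y) ∙ g ⁻¹        ≈⟨ ∙-congʳ (assoc _ _ _) ⟨
    g ∙ x ∙ y ∙ g ⁻¹          ≈⟨ ∙-congʳ (∙-congʳ (conj-move g x)) ⟨
    conj g x ∙ g ∙ y ∙ g ⁻¹   ≈⟨ ∙-congʳ (assoc _ _ _) ⟩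
    conj g x ∙ (g ∙ y) ∙ g ⁻¹ ≈⟨ assoc _ _ _ ⟩
    conj g x ∙ conj g y       ∎

  conj-∘ : ∀ g h x → conj (g ∙ h) x ≈ conj g (conj h x)
  conj-∘ g h x = begin
    g ∙ h ∙ x ∙ (g ∙ h) ⁻¹       ≈⟨ ∙-cong (assoc _ _ _) (⁻¹-anti-homo-∙ g h) ⟩
    g ∙ (h ∙ x) ∙ (h ⁻¹ ∙ g ⁻¹)  ≈⟨ assoc _ _ _ ⟨
    g ∙ (h ∙ x) ∙ h ⁻¹ ∙ g ⁻¹    ≈⟨ ∙-congʳ (assoc _ _ _) ⟩
    g ∙ conj h x ∙ g ⁻¹          ∎
    where open import Algebra.Properties.Group G using (⁻¹-anti-homo-∙)

  conj-ε-id : ∀ x → conj ε x ≈ x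
  conj-ε-id x = trans (∙-cong (identityˡ x) ε⁻¹≈ε) (identityʳ x)
    where open import Algebra.Properties.Group G using (ε⁻¹≈ε)

  conj-congˡ : ∀ {g h} x → g ≈ h → conj g x ≈ conj h x
  conj-congˡ x g≈h = ∙-cong (∙-congʳ g≈h) (⁻¹-cong g≈h)

  conj-^ : ∀ g x n → conj g x ^ n ≈ conj g (x ^ n)
  conj-^ g x zero    = sym (conj-ε g)
  conj-^ g x (suc n) = trans (∙-congˡ (conj-^ g x n)) (sym (conj-∙ g x (x ^ n)))

  -- Two elements adjacent or equal in the enhanced power graph of a finite
  -- group are exactly two powers of a common element.
  Cocyclic : Carrier → Carrier → Set (c ⊔ ℓ)
  Cocyclic x y = ∃ λ g → (∃ λ i → g ^ i ≈ x) × (∃ λ j → g ^ j ≈ y)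

  cocyclic-refl : ∀ {x} → Cocyclic x x
  cocyclic-refl {x} = x , (1 , ^1 x) , (1 , ^1 x)

  cocyclic-sym : ∀ {x y} → Cocyclic x y → Cocyclic y x
  cocyclic-sym (g , x∈ , y∈) = g , y∈ , x∈

  cocyclic-resp : ∀ {x x′ y y′} → x ≈ x′ → y ≈ y′ → Cocyclic x y → Cocyclic x′ y′
  cocyclic-resp x≈ y≈ (g , (i , gi) , (j , gj)) = g , (i , trans gi x≈) , (j , trans gj y≈)

  cocyclic-ε : ∀ y → Cocyclic ε y
  cocyclic-ε y = y , (0 , refl) , (1 , ^1 y)

  -- In a finite group this already describes subgroups: the inverse of an element is one of its
  -- powers.
  record IsSubmonoid {p} (Q : Carrier → Set p) : Set (c ⊔ ℓ ⊔ p) where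
    field
      ≈∈   : ∀ {x y} → x ≈ y → Q x → Q y
      ε∈   : Q ε
      ∙∈   : ∀ {x y} → Q x → Q y → Q (x ∙ y)

    ^∈ : ∀ {x} n → Q x → Q (x ^ n)
    ^∈ zero    _  = ε∈
    ^∈ (suc n) qx = ∙∈ qx (^∈ n qx)

  powers-submonoid : ∀ g → IsSubmonoid (λ x → ∃ λ i → g ^ i ≈ x)
  powers-submonoid g = record
    { ≈∈   = λ x≈y (i , gi) → i , trans gi x≈y
    ; ε∈   = 0 , refl
    ; ∙∈   = λ (i , gi) (j , gj) → i + j , trans (^-+ g i j) (∙-cong gi gj)
    }

module _ {c ℓ c′ ℓ′} (G : Group c ℓ) (H : Group c′ ℓ′) where
  private
    module G = Group G
    module H = Group H
    open module PG = Powers G using () renaming (_^_ to _^ᴳ_)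
    open module PH = Powers H using () renaming (_^_ to _^ᴴ_)

  module _ {f : G.Carrier → H.Carrier} (hom : IsGroupHomomorphism G.rawGroup H.rawGroup f) where
    open IsGroupHomomorphism hom

    homo-^ : ∀ x n → f (x ^ᴳ n) H.≈ f x ^ᴴ n
    homo-^ x zero    = ε-homo
    homo-^ x (suc n) = H.trans (homo x (x ^ᴳ n)) (H.∙-congˡ (homo-^ x n))

    homo-cocyclic : ∀ {x y} → PG.Cocyclic x y → PH.Cocyclic (f x) (f y)
    homo-cocyclic (g , (i , gi) , (j , gj)) =
      f g , (i , H.trans (H.sym (homo-^ g i)) (⟦⟧-cong gi))
          , (j , H.trans (H.sym (homo-^ g j)) (⟦⟧-cong gj))

  ∙-homo⇒groupHomomorphism : ∀ {f} → f Preserves G._≈_ ⟶ H._≈_ →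
    (∀ x y → f (x G.∙ y) H.≈ f x H.∙ f y) → IsGroupHomomorphism G.rawGroup H.rawGroup f
  ∙-homo⇒groupHomomorphism {f} f-cong f-∙ = record
    { isMonoidHomomorphism = record
      { isMagmaHomomorphism = record
        { isRelHomomorphism = record { cong = f-cong } ; homo = f-∙ }
      ; ε-homo = f-ε
      }
    ; ⁻¹-homo = λ x → inverseˡ-unique _ _
        (H.trans (H.sym (f-∙ _ _)) (H.trans (f-cong (G.inverseˡ x)) f-ε))
    }
    where
    open import Algebra.Properties.Group H using (inverseˡ-unique; identityˡ-unique)
    f-ε : f G.ε H.≈ H.ε
    f-ε = identityˡ-unique _ _ (H.trans (H.sym (f-∙ _ _)) (f-cong (G.identityˡ G.ε)))

-- Subgroups of a finite group

module Finite {c ℓ} (F : FiniteGroup c ℓ) where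
  open Group (group F)
  open Powers (group F)
  open import Algebra.Properties.Group (group F)
  open Inverse (FiniteGroup.enumeration F) public
    using () renaming (to to index; from to element; to-cong to index-cong;
                       strictlyInverseˡ to index-element; strictlyInverseʳ to element-index)
  open import Relation.Binary.Reasoning.Setoid setoid

  index-injective : ∀ {x y} → index x ≡ index y → x ≈ y
  index-injective {x} {y} eq =
    trans (sym (element-index x)) (trans (reflexive (cong element eq)) (element-index y))

  infix 4 _≟_
  _≟_ : ∀ x y → Dec (x ≈ y)
  x ≟ y = map′ index-injective index-cong (index x Fin.≟ index y)

  search : ∀ {q} {Q : Carrier → Set q} → (∀ {x y} → x ≈ y → Q x → Q y) →
           (∀ x → Dec (Q x)) → Dec (∃ Q)
  search Q-resp Q? = map′ (λ (i , q) → element i , q)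
    (λ (x , q) → index x , Q-resp (sym (element-index x)) q) (any? (Q? ∘ element))

  -- Pigeonhole: among the powers with exponents from 0 to the group order two coincide, and the
  -- positive difference of their exponents kills `x`.
  finiteOrder : ∀ x → ∃ λ m → x ^ suc m ≈ ε
  finiteOrder x with pigeonhole (n<1+n (order F)) (λ i → index (x ^ toℕ i))
  ... | i , j , i<j , eq with m≤n⇒∃[o]m+o≡n i<j
  ...   | o , i+o≡j = o , identityʳ-unique (x ^ toℕ i) (x ^ suc o) (begin
    x ^ toℕ i ∙ x ^ suc o  ≈⟨ ^-+ x (toℕ i) (suc o) ⟨
    x ^ (toℕ i + suc o)    ≈⟨ ^-congʳ x (≡.trans (+-suc (toℕ i) o) i+o≡j) ⟩
    x ^ toℕ j              ≈⟨ index-injective eq ⟨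
    x ^ toℕ i              ∎)

  module _ {q} {Q : Carrier → Set q} (Q-sub : IsSubmonoid Q) where
    open IsSubmonoid Q-sub

    ⁻¹∈ : ∀ {x} → Q x → Q (x ⁻¹)
    ⁻¹∈ {x} qx with finiteOrder x
    ... | m , eq = ≈∈ (inverseʳ-unique x (x ^ m) eq) (^∈ m qx)

    cancelˡ∈ : ∀ {x y} → Q x → Q (x ∙ y) → Q y
    cancelˡ∈ {x} {y} qx qxy = ≈∈ (\\-leftDividesʳ x y) (∙∈ (⁻¹∈ qx) qxy)

    cancelʳ∈ : ∀ {x y} → Q y → Q (x ∙ y) → Q x
    cancelʳ∈ {x} {y} qy qxy = ≈∈ (//-rightDividesʳ y x) (∙∈ qxy (⁻¹∈ qy))

  -- Given by a list without repetition, so that membership is decidable and the size is available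
  -- for counting.
  record Subgroup : Set (c ⊔ ℓ) where
    infix 4 ∈_
    field
      size           : ℕ
      elem           : Fin size → Carrier
      elem-injective : ∀ {i j} → elem i ≈ elem j → i ≡ j

    ∈_ : Carrier → Set ℓ
    ∈ x = ∃ λ i → elem i ≈ x

    field
      isSubmonoid : IsSubmonoid ∈_

    open IsSubmonoid isSubmonoid public

    ∈? : ∀ x → Dec (∈ x)
    ∈? x = any? (λ i → elem i ≟ x)

    size≤order : size ≤ order F
    size≤order = injective⇒≤ {f = index ∘ elem} (elem-injective ∘ index-injective)

    0<size : 0 < size
    0<size = ≤-<-trans z≤n (toℕ<n (proj₁ ε∈))

    -- Conjugation is injective and the subgroup finite, so mapping it into itself amounts to
    -- mapping it onto itself.
    Normalises : Carrier → Set (c ⊔ ℓ)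
    Normalises g = ∀ x → ∈ x → ∈ conj g x

    normaliser : IsSubmonoid Normalises
    normaliser = record
      { ≈∈ = λ g≈h n x x∈ → ≈∈ (conj-congˡ x g≈h) (n x x∈)
      ; ε∈ = λ x → ≈∈ (sym (conj-ε-id x))
      ; ∙∈ = λ {g} {h} ng nh x x∈ → ≈∈ (sym (conj-∘ g h x)) (ng _ (nh x x∈))
      }

    normalises? : ∀ g → Dec (Normalises g)
    normalises? g = map′
      (λ n x (i , eq) → ≈∈ (conj-cong g eq) (n i)) (λ n i → n (elem i) (i , refl))
      (Fin.all? (λ i → ∈? (conj g (elem i))))

  trivial : Subgroup
  trivial = record
    { size = 1 ; elem = λ _ → ε ; elem-injective = λ { {zero} {zero} _ → ≡.refl }
    ; isSubmonoid = record
      { ≈∈ = λ x≈y (i , eq) → i , trans eq x≈y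
      ; ε∈ = zero , refl
      ; ∙∈ = λ (_ , p) (_ , q) → zero , trans (sym (identityˡ ε)) (∙-cong p q)
      }
    }

  -- The subgroup `H⟨x⟩` for `x` normalising `H`; `index′` is its index over `H`, that is, the order
  -- of the coset of `x` in `N(H)/H`.
  record Extension (H : Subgroup) (x : Carrier) : Set (c ⊔ ℓ) where
    private module H = Subgroup H
    field
      index′   : ℕ
      extended : Subgroup
    private module K = Subgroup extended
    field
      size≡    : K.size ≡ index′ * H.size
      x^index∈ : H.∈ x ^ index′
      minimal  : ∀ m → H.∈ x ^ m → index′ ∣ m
      ∈⇒       : ∀ {y} → K.∈ y → ∃₂ λ h j → H.∈ h × h ∙ x ^ j ≈ y

  -- With `d` the least positive exponent for which `x ^ d` lies in `H`, the products `h ∙ x ^ r`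
  -- with `h` in `H` and `r < d` list `H⟨x⟩` without repetition.
  extend : ∀ H x → Subgroup.Normalises H x → Extension H x
  extend H x x-norm with finiteOrder x
  ... | o , x^1+o≈ε with leastPositive (λ k → Subgroup.∈? H (x ^ k)) (suc o) z<s
                           (IsSubmonoid.≈∈ (Subgroup.isSubmonoid H) (sym x^1+o≈ε)
                             (IsSubmonoid.ε∈ (Subgroup.isSubmonoid H)))
  ...   | d@(suc _) , _ , x^d∈ , least = record
    { index′ = d
    ; extended = record
      { size = d * size ; elem = elem′ ; elem-injective = elem′-injective
      ; isSubmonoid = record
        { ≈∈ = λ y≈z (k , eq) → k , trans eq y≈z
        ; ε∈ = mem 0 ε∈ (identityʳ ε)
        ; ∙∈ = ∙-closed
        }
      }
    ; size≡ = ≡.refl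
    ; x^index∈ = x^d∈
    ; minimal = λ m x^m∈ → m%n≡0⇒n∣m m d (rem≡0 m x^m∈)
    ; ∈⇒ = unmem
    }
    where
    open Subgroup H

    elem′ : Fin (d * size) → Carrier
    elem′ k = elem (proj₂ (remQuot {d} size k)) ∙ x ^ toℕ (proj₁ (remQuot {d} size k))

    low : ∀ m → m < d → ∈ x ^ m → m ≡ 0
    low zero    _   _  = ≡.refl
    low (suc m) m<d m∈ = ⊥-elim (least (suc m) z<s m<d m∈)

    x^*d∈ : ∀ q → ∈ x ^ (q * d)
    x^*d∈ q = ≈∈ (trans (sym (^-* x d q)) (^-congʳ x (*-comm d q))) (^∈ q x^d∈)

    rem≡0 : ∀ m → ∈ x ^ m → m % d ≡ 0
    rem≡0 m x^m∈ = low (m % d) (m%n<n m d) (cancelʳ∈ isSubmonoid (x^*d∈ (m / d))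
      (≈∈ (trans (^-congʳ x (m≡m%n+[m/n]*n m d)) (^-+ x (m % d) _)) x^m∈))

    mem : ∀ {h y} j → ∈ h → h ∙ x ^ j ≈ y → ∃ λ k → elem′ k ≈ y
    mem {h} {y} j h∈ eq with ∙∈ h∈ (x^*d∈ (j / d))
    ... | i , eqᵢ = combine (fromℕ< (m%n<n j d)) i , (begin
      elem′ (combine (fromℕ< (m%n<n j d)) i)
        ≈⟨ reflexive (cong (λ (r , i) → elem i ∙ x ^ toℕ r) (remQuot-combine (fromℕ< (m%n<n j d)) i)) ⟩
      elem i ∙ x ^ toℕ (fromℕ< (m%n<n j d))   ≈⟨ ∙-cong eqᵢ (^-congʳ x (toℕ-fromℕ< (m%n<n j d))) ⟩
      h ∙ x ^ (j / d * d) ∙ x ^ (j % d)       ≈⟨ assoc _ _ _ ⟩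
      h ∙ (x ^ (j / d * d) ∙ x ^ (j % d))     ≈⟨ ∙-congˡ (^-+ x (j / d * d) (j % d)) ⟨
      h ∙ x ^ (j / d * d + j % d)
        ≈⟨ ∙-congˡ (^-congʳ x (≡.trans (m≡m%n+[m/n]*n j d) (+-comm (j % d) (j / d * d)))) ⟨
      h ∙ x ^ j                               ≈⟨ eq ⟩
      y                                       ∎)

    unmem : ∀ {y} → (∃ λ k → elem′ k ≈ y) → ∃₂ λ h j → ∈ h × h ∙ x ^ j ≈ y
    unmem (k , eq) = _ , toℕ (proj₁ (remQuot {d} size k)) , (_ , refl) , eq

    ∙-closed : ∀ {y z} → (∃ λ k → elem′ k ≈ y) → (∃ λ k → elem′ k ≈ z) → ∃ λ k → elem′ k ≈ y ∙ z
    ∙-closed {y} {z} y∈ z∈ with unmem y∈ | unmem z∈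
    ... | h , j , h∈ , y≈ | h′ , j′ , h′∈ , z≈ =
      -- Moving `x ^ j` to the right past `h′` conjugates `h′`, which stays in `H` because powers of
      -- `x` normalise `H`.
      mem (j + j′) (∙∈ h∈ (IsSubmonoid.^∈ normaliser j x-norm h′ h′∈)) (begin
        h ∙ conj (x ^ j) h′ ∙ x ^ (j + j′)        ≈⟨ ∙-congˡ (^-+ x j j′) ⟩
        h ∙ conj (x ^ j) h′ ∙ (x ^ j ∙ x ^ j′)    ≈⟨ assoc _ _ _ ⟩
        h ∙ (conj (x ^ j) h′ ∙ (x ^ j ∙ x ^ j′))  ≈⟨ ∙-congˡ (assoc _ _ _) ⟨
        h ∙ (conj (x ^ j) h′ ∙ x ^ j ∙ x ^ j′)    ≈⟨ ∙-congˡ (∙-congʳ (conj-move (x ^ j) h′)) ⟩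
        h ∙ (x ^ j ∙ h′ ∙ x ^ j′)                 ≈⟨ ∙-congˡ (assoc _ _ _) ⟩
        h ∙ (x ^ j ∙ (h′ ∙ x ^ j′))               ≈⟨ assoc _ _ _ ⟨
        h ∙ x ^ j ∙ (h′ ∙ x ^ j′)                 ≈⟨ ∙-cong y≈ z≈ ⟩
        y ∙ z                                     ∎)

    -- Cancelling the smaller power leaves `x ^ o` in `H` with `o < d`, and minimality of `d` forces
    -- `o` to be 0.
    exponents≡ : ∀ {h h′ j j′} → ∈ h → ∈ h′ → j′ < d → j ≤ j′ →
                 h ∙ x ^ j ≈ h′ ∙ x ^ j′ → j ≡ j′
    exponents≡ {h} {h′} {j} h∈ h′∈ j′<d j≤j′ eq with m≤n⇒∃[o]m+o≡n j≤j′
    ... | o , ≡.refl = ≡.sym (≡.trans (cong (j +_) o≡0) (+-identityʳ j))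
      where
      h≈ : h ≈ h′ ∙ x ^ o
      h≈ = ∙-cancelʳ (x ^ j) _ _ (begin
        h ∙ x ^ j             ≈⟨ eq ⟩
        h′ ∙ x ^ (j + o)      ≈⟨ ∙-congˡ (trans (^-congʳ x (+-comm j o)) (^-+ x o j)) ⟩
        h′ ∙ (x ^ o ∙ x ^ j)  ≈⟨ assoc _ _ _ ⟨
        h′ ∙ x ^ o ∙ x ^ j    ∎)
      o≡0 : o ≡ 0
      o≡0 = low o (≤-<-trans (m≤n+m o j) j′<d) (cancelˡ∈ isSubmonoid h′∈ (≈∈ h≈ h∈))

    pair-injective : ∀ {r r′ : Fin d} {i i′} →
                     elem i ∙ x ^ toℕ r ≈ elem i′ ∙ x ^ toℕ r′ → (r , i) ≡ (r′ , i′)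
    pair-injective {r} {r′} {i} {i′} eq = cong₂ _,_ r≡r′ (elem-injective
      (∙-cancelʳ _ _ _ (trans eq (∙-congˡ (^-congʳ x (cong toℕ (≡.sym r≡r′)))))))
      where
      r≡r′ : r ≡ r′
      r≡r′ with ≤-total (toℕ r) (toℕ r′)
      ... | inj₁ r≤r′ = toℕ-injective (exponents≡ (i , refl) (i′ , refl) (toℕ<n r′) r≤r′ eq)
      ... | inj₂ r′≤r =
        toℕ-injective (≡.sym (exponents≡ (i′ , refl) (i , refl) (toℕ<n r) r′≤r (sym eq)))

    elem′-injective : ∀ {k k′} → elem′ k ≈ elem′ k′ → k ≡ k′
    elem′-injective {k} {k′} eq = ≡.trans (≡.sym (combine-remQuot {d} size k))
      (≡.trans (cong (uncurry combine) (pair-injective {proj₁ (remQuot {d} size k)} {proj₁ (remQuot {d} size k′)} eq)) (combine-remQuot {d} size k′))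

  -- Cosets and Lagrange's theorem

  module _ (H : Subgroup) where
    open Subgroup H

    private
      Covered : ∀ {r} → (Fin r → Carrier) → Carrier → Set ℓ
      Covered reps y = ∃₂ λ i a → elem a ∙ reps i ≈ y

      DistinctCosets : ∀ {r} → (Fin r → Carrier) → Set ℓ
      DistinctCosets reps = ∀ i j a b → elem a ∙ reps i ≈ elem b ∙ reps j → i ≡ j

      covered? : ∀ {r} (reps : Fin r → Carrier) y → Dec (Covered reps y)
      covered? reps y = any? λ i → any? λ a → elem a ∙ reps i ≟ y

      same-coset : ∀ {r} {reps : Fin r → Carrier} {y} i a b → elem a ∙ y ≈ elem b ∙ reps i → Covered reps y
      same-coset {reps = reps} {y} i a b eq with ∙∈ (⁻¹∈ isSubmonoid (a , refl)) (b , refl)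
      ... | e , eq′ = i , e , (begin
        elem e ∙ reps i                  ≈⟨ ∙-congʳ eq′ ⟩
        elem a ⁻¹ ∙ elem b ∙ reps i      ≈⟨ assoc _ _ _ ⟩
        elem a ⁻¹ ∙ (elem b ∙ reps i)    ≈⟨ ∙-congˡ eq ⟨
        elem a ⁻¹ ∙ (elem a ∙ y)         ≈⟨ \\-leftDividesʳ (elem a) y ⟩
        y                                ∎)

      distinct-∷ : ∀ {r} {reps : Fin r → Carrier} {y} → ¬ Covered reps y →
                   DistinctCosets reps → DistinctCosets (y ∷ᶠ reps)
      distinct-∷ new dist zero    zero    a b eq = ≡.refl
      distinct-∷ new dist zero    (suc j) a b eq = ⊥-elim (new (same-coset j a b eq))
      distinct-∷ new dist (suc i) zero    a b eq = ⊥-elim (new (same-coset i b a (sym eq)))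
      distinct-∷ new dist (suc i) (suc j) a b eq = cong suc (dist i j a b eq)

      module _ {r} (reps : Fin r → Carrier) (dist : DistinctCosets reps) where
        point : Fin (r * size) → Carrier
        point k = elem (proj₂ (remQuot {r} size k)) ∙ reps (proj₁ (remQuot {r} size k))

        point-injective : ∀ {k k′} → point k ≈ point k′ → k ≡ k′
        point-injective {k} {k′} eq = ≡.trans (≡.sym (combine-remQuot {r} size k))
          (≡.trans (cong (uncurry combine) (cong₂ _,_ i≡j (elem-injective
             (∙-cancelʳ _ _ _ (trans eq (∙-congˡ (reflexive (cong reps (≡.sym i≡j)))))))))
           (combine-remQuot {r} size k′))
          where i≡j = dist _ _ _ _ eq

        points≤order : r * size ≤ order F
        points≤order = injective⇒≤ {f = index ∘ point} (point-injective ∘ index-injective)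

        order≤points : (∀ y → Covered reps y) → order F ≤ r * size
        order≤points cov = injective⇒≤ {f = pos} λ {k} {k′} eq →
          ≡.trans (≡.sym (index-element k)) (≡.trans (index-cong
            (trans (sym (pos-point k)) (trans (reflexive (cong point eq)) (pos-point k′))))
            (index-element k′))
          where
          pos : Fin (order F) → Fin (r * size)
          pos k with i , a , _ ← cov (element k) = combine i a
          pos-point : ∀ k → point (pos k) ≈ element k
          pos-point k with i , a , eq ← cov (element k) =
            trans (reflexive (cong (λ (i , a) → elem a ∙ reps i) (remQuot-combine i a))) eq

      -- Each round adds a representative outside the right cosets found so far. Since
      -- `r ≤ r * size ≤ order F`, the fuel cannot run out; once everything is covered, the disjoint
      -- cosets give `order F ≡ r * size`.
      grow : ∀ fuel {r} → order F < fuel + r → (reps : Fin r → Carrier) → DistinctCosets reps →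
             size ∣ order F
      grow fuel {r} N<fuel+r reps dist
        with search (λ x≈y ¬c (i , a , eq) → ¬c (i , a , trans eq (sym x≈y))) (¬? ∘ covered? reps)
      ... | no all-covered = divides r (≤-antisym (order≤points reps dist
              (λ y → decidable-stable (covered? reps y) (λ ¬c → all-covered (y , ¬c))))
            (points≤order reps dist))
      grow zero {r} N<r reps dist | yes _ = ⊥-elim (<-irrefl ≡.refl (<-≤-trans N<r
        (≤-trans (m≤m*n r size {{>-nonZero 0<size}}) (points≤order reps dist))))
      grow (suc fuel) {r} N<fuel+r reps dist | yes (y , new) =
        grow fuel (subst (order F <_) (≡.sym (+-suc fuel r)) N<fuel+r) (y ∷ᶠ reps) (distinct-∷ new dist)

    lagrange : size ∣ order F
    lagrange = grow (suc (order F)) (m≤m+n (suc (order F)) 0) (λ ()) (λ ())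

  record ElementOrder (x : Carrier) : Set ℓ where
    field
      ord       : ℕ
      ^-ord     : x ^ ord ≈ ε
      ord∣      : ∀ m → x ^ m ≈ ε → ord ∣ m
      ord∣order : ord ∣ order F

  abstract
    -- The order of `x` is the index of the trivial subgroup in its extension by `x`, so Lagrange
    -- applies to `⟨x⟩`.
    elementOrder : ∀ x → ElementOrder x
    elementOrder x = record
      { ord       = index′
      ; ^-ord     = sym (proj₂ x^index∈)
      ; ord∣      = λ m x^m≈ε → minimal m (zero , sym x^m≈ε)
      ; ord∣order = subst (_∣ order F) (≡.trans size≡ (*-identityʳ index′)) (lagrange extended)
      }
      where
      open Extension (extend trivial x (λ y (i , eq) → i , trans (sym (conj-ε x)) (conj-cong x eq)))

  ^-order : ∀ x → x ^ order F ≈ ε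
  ^-order x = ^≈ε-∣ ^-ord ord∣order
    where open ElementOrder (elementOrder x)

-- Claws in enhanced power graphs

-- For the reflexive relation `Cocyclic` these clauses force four distinct vertices. A leaf is
-- non-dominating because another leaf is unrelated to it, so only the centre needs its own clause.
Claw : ∀ {a r} {A : Set a} → (A → A → Set r) → Set (a ⊔ r)
Claw {A = A} R = Σ A λ x → Σ (Fin 3 → A) λ l →
  (∀ i → R x (l i)) × (∀ i j → ¬ i ≡ j → ¬ R (l i) (l j)) × ¬ (∀ y → R x y)

claw-map : ∀ {a b r s} {A : Set a} {B : Set b} {R : A → A → Set r} {S : B → B → Set s} (h : A → B) →
           (∀ x y → R x y → S (h x) (h y)) → (∀ x y → S (h x) (h y) → R x y) → Claw R → Claw S
claw-map h to from (x , l , adj , indep , ¬dom) =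
  h x , h ∘ l , (λ i → to _ _ (adj i)) , (λ i j i≢j → indep i j i≢j ∘ from _ _)
  , λ dom → ¬dom λ y → from x y (dom (h y))

module _ {v e r} (Γ : SimpleGraph v e r) where
  open SimpleGraph Γ
  private module K = SimpleGraph (K 1 3)

  K₁₃⇒¬clawFree : (h : K.Vertex → Vertex) → (∀ {k k′} → h k ≈ h k′ → k ≡ k′) →
                  (∀ k k′ → h k ~ h k′ ⇔ k K.~ k′) → ¬ ClawFree Γ
  -- The induced copy lives on the image of `h`, closed under vertex equality.
  K₁₃⇒¬clawFree h h-inj adj free = free (λ w → ∃ λ k → h k ≈ w) record
    { bijection = record
      { to        = proj₁ ∘ proj₂
      ; from      = λ k → h k , k , V.refl
      ; to-cong   = λ { {_ , _ , hk} {_ , _ , hk′} w≈w′ → h-inj (V.trans hk (V.trans w≈w′ (V.sym hk′))) }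
      ; from-cong = λ k≡k′ → V.reflexive (cong h k≡k′)
      ; inverse   = (λ { {k} {_ , _ , hk′} eq → h-inj (V.trans hk′ eq) }) , λ { {_ , _ , hk} ≡.refl → hk }
      }
    ; adjacency = λ { (w , k , hk) (w′ , k′ , hk′) → mk⇔
        (λ w~w′ → Equivalence.to (adj k k′) (resp₂ (V.sym hk) (V.sym hk′) w~w′))
        (λ k~k′ → resp₂ hk hk′ (Equivalence.from (adj k k′) k~k′)) }
    }
    where
    module V = Setoid vertices
    resp₂ : ∀ {x x′ y y′} → x ≈ x′ → y ≈ y′ → x ~ y → x′ ~ y′
    resp₂ x≈ y≈ = proj₁ ~-resp-≈ y≈ ∘ proj₂ ~-resp-≈ x≈

  noK₁₃⇒clawFree : (∀ (h : K.Vertex → Vertex) → (∀ {k k′} → h k ≈ h k′ → k ≡ k′) →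
                  (∀ k k′ → h k ~ h k′ ⇔ k K.~ k′) → ⊥) → ClawFree Γ
  noK₁₃⇒clawFree none S iso = none (proj₁ ∘ from)
    (λ {k} {k′} eq → ≡.trans (≡.sym (strictlyInverseˡ k)) (≡.trans (to-cong eq) (strictlyInverseˡ k′)))
    (λ k k′ → ≡.subst₂ (λ l l′ → proj₁ (from k) ~ proj₁ (from k′) ⇔ l K.~ l′)
      (strictlyInverseˡ k) (strictlyInverseˡ k′) (adjacency (from k) (from k′)))
    where
    open _≅_ iso
    open Inverse bijection

-- Cyclic subgroups and claw-freeness in terms of common roots

module Cyclicity {c ℓ} (F : FiniteGroup c ℓ) where
  open Group (group F)
  open Powers (group F)
  open Finite F

  instance
    order≢0 : NonZero (order F)
    order≢0 = nonZeroIndex (index ε)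

  ⟨⟩-⊆ : ∀ {p q} {S : Pred Carrier p} {Q : Carrier → Set q} → IsSubmonoid Q →
         (∀ {x} → S x → Q x) → ∀ {x} → ⟨_⟩ (group F) S x → Q x
  ⟨⟩-⊆ sub S⊆Q (gen s)    = S⊆Q s
  ⟨⟩-⊆ sub S⊆Q one        = IsSubmonoid.ε∈ sub
  ⟨⟩-⊆ sub S⊆Q (mul x y)  = IsSubmonoid.∙∈ sub (⟨⟩-⊆ sub S⊆Q x) (⟨⟩-⊆ sub S⊆Q y)
  ⟨⟩-⊆ sub S⊆Q (inv x)    = ⁻¹∈ sub (⟨⟩-⊆ sub S⊆Q x)
  ⟨⟩-⊆ sub S⊆Q (resp e x) = IsSubmonoid.≈∈ sub e (⟨⟩-⊆ sub S⊆Q x)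

  ⟨⟩-submonoid : ∀ {p} {S : Pred Carrier p} → IsSubmonoid (⟨_⟩ (group F) S)
  ⟨⟩-submonoid = record { ≈∈ = resp ; ε∈ = one ; ∙∈ = mul }

  ∈⟨⟩⇒power : ∀ {g x} → ⟨_⟩ (group F) ｛ g ｝ x → ∃ λ i → g ^ i ≈ x
  ∈⟨⟩⇒power {g} = ⟨⟩-⊆ (powers-submonoid g) λ { ≡.refl → 1 , ^1 g }

  power∈⟨⟩ : ∀ {g x} → (∃ λ i → g ^ i ≈ x) → ⟨_⟩ (group F) ｛ g ｝ x
  power∈⟨⟩ (i , gi) = resp gi (IsSubmonoid.^∈ ⟨⟩-submonoid i (gen ≡.refl))

  generateCyclic⇒cocyclic : ∀ {x y} → GenerateCyclic (group F) x y → Cocyclic x y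
  generateCyclic⇒cocyclic (g , ⊆g , _) =
    g , ∈⟨⟩⇒power (⊆g (gen (inj₁ ≡.refl))) , ∈⟨⟩⇒power (⊆g (gen (inj₂ ≡.refl)))

  -- The powers `g ^ i` and `g ^ j` generate the same subgroup as `g ^ gcd i j`; a Bézout identity
  -- in natural numbers recovers this power after one cancellation.
  cocyclic⇒generateCyclic : ∀ {x y} → Cocyclic x y → GenerateCyclic (group F) x y
  cocyclic⇒generateCyclic {x} {y} (g , (i , gi) , (j , gj)) =
    g ^ d , ⟨⟩-⊆ ⟨⟩-submonoid (λ { (inj₁ ≡.refl) → via-d gi (gcd[m,n]∣m i j)
                                 ; (inj₂ ≡.refl) → via-d gj (gcd[m,n]∣n i j) })
          , ⟨⟩-⊆ ⟨⟩-submonoid λ { ≡.refl → g^d∈ (Bézout.identity (gcd-GCD i j)) }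
    where
    d = gcd i j
    Span : Carrier → Set _
    Span = ⟨_⟩ (group F) (｛ x ｝ ∪ ｛ y ｝)

    via-d : ∀ {z k} → g ^ k ≈ z → d ∣ k → ⟨_⟩ (group F) ｛ g ^ d ｝ z
    via-d gk (divides q k≡) = power∈⟨⟩ (q , trans (sym (^-* g d q))
      (trans (^-congʳ g (≡.trans (*-comm d q) (≡.sym k≡))) gk))

    multiple∈ : ∀ {z k} s → g ^ k ≈ z → Span z → Span (g ^ (s * k))
    multiple∈ {k = k} s gk z∈ = resp (trans (^-congˡ s (sym gk)) (trans (sym (^-* g k s)) (^-congʳ g (*-comm k s))))
      (IsSubmonoid.^∈ ⟨⟩-submonoid s z∈)

    g^d∈ : Bézout.Identity d i j → Span (g ^ d)
    g^d∈ (Bézout.+- a b eq) = cancelʳ∈ ⟨⟩-submonoid (multiple∈ b gj (gen (inj₂ ≡.refl)))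
      (resp (trans (^-congʳ g (≡.sym eq)) (^-+ g d (b * j))) (multiple∈ a gi (gen (inj₁ ≡.refl))))
    g^d∈ (Bézout.-+ a b eq) = cancelʳ∈ ⟨⟩-submonoid (multiple∈ a gi (gen (inj₁ ≡.refl)))
      (resp (trans (^-congʳ g (≡.sym eq)) (^-+ g d (a * i))) (multiple∈ b gj (gen (inj₂ ≡.refl))))

  isCyclic : ∀ g → (∀ x → ∃ λ i → g ^ i ≈ x) → IsCyclic (group F)
  isCyclic g all = g , (λ _ → power∈⟨⟩ (all _)) , _

  isCyclic⇒cocyclic : IsCyclic (group F) → ∀ x y → Cocyclic x y
  isCyclic⇒cocyclic (g , ⊆g , _) x y = g , ∈⟨⟩⇒power (⊆g _) , ∈⟨⟩⇒power (⊆g _)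

  ^-% : ∀ {g n} .{{_ : NonZero n}} j → g ^ n ≈ ε → g ^ (j % n) ≈ g ^ j
  ^-% {g} {n} j gⁿ≈ε = sym (trans (^-congʳ g (m≡m%n+[m/n]*n j n)) (trans (^-+ g (j % n) (j / n * n))
    (trans (∙-congˡ (^≈ε-∣ gⁿ≈ε (n∣m*n (j / n)))) (identityʳ _))))

  -- By Lagrange exponents matter only modulo the group order, which makes the search finite.
  power? : ∀ g x → Dec (∃ λ i → g ^ i ≈ x)
  power? g x = map′ (λ (i , gi) → toℕ i , gi)
    (λ (j , gj) → fromℕ< (m%n<n j (order F)) ,
      trans (^-congʳ g (toℕ-fromℕ< (m%n<n j (order F)))) (trans (^-% j (^-order g)) gj))
    (any? λ i → g ^ toℕ i ≟ x)

  cocyclic? : ∀ x y → Dec (Cocyclic x y)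
  cocyclic? x y = search
    (λ g≈h ((i , gi) , (j , gj)) → (i , trans (^-congˡ i (sym g≈h)) gi) , (j , trans (^-congˡ j (sym g≈h)) gj))
    (λ g → power? g x ×-dec power? g y)

  private
    module E = SimpleGraph (enhancedPowerGraph (group F))
    module E** = SimpleGraph (properEnhancedPowerGraph (group F))

    dominating⇒ : ∀ {x} → E.Dominating x → ∀ y → Cocyclic x y
    dominating⇒ {x} dom y with x ≟ y
    ... | yes x≈y = cocyclic-resp refl x≈y cocyclic-refl
    ... | no x≉y = generateCyclic⇒cocyclic (proj₂ (dom y x≉y))

    ⇒dominating : ∀ {x} → (∀ y → Cocyclic x y) → E.Dominating x
    ⇒dominating all y x≉y = x≉y , cocyclic⇒generateCyclic (all y)

    other : (i : Fin 3) → ∃ λ j → ¬ i ≡ j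
    other zero    = suc zero , λ ()
    other (suc _) = zero , λ ()

  clawFree⇒¬claw : ClawFree (properEnhancedPowerGraph (group F)) → ¬ Claw Cocyclic
  clawFree⇒¬claw free (x , l , adj , indep , ¬dom) =
    K₁₃⇒¬clawFree (properEnhancedPowerGraph (group F)) h
      (λ {k} {k′} → h-inj k k′) h-adj free
    where
    h : Fin 1 ⊎ Fin 3 → E**.Vertex
    h (inj₁ _) = x , ¬dom ∘ dominating⇒
    h (inj₂ i) = l i , λ dom → indep i _ (proj₂ (other i)) (dominating⇒ dom _)

    x≉l : ∀ i → ¬ x ≈ l i
    x≉l i x≈l = indep i _ (proj₂ (other i)) (cocyclic-resp x≈l refl (adj _))

    l-inj : ∀ i j → l i ≈ l j → i ≡ j
    l-inj i j eq = decidable-stable (i Fin.≟ j) λ i≢j → indep i j i≢j (cocyclic-resp refl eq cocyclic-refl)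

    h-inj : ∀ k k′ → h k E**.≈ h k′ → k ≡ k′
    h-inj (inj₁ zero) (inj₁ zero) _  = ≡.refl
    h-inj (inj₁ _)    (inj₂ i)    eq = ⊥-elim (x≉l i eq)
    h-inj (inj₂ i)    (inj₁ _)    eq = ⊥-elim (x≉l i (sym eq))
    h-inj (inj₂ i)    (inj₂ j)    eq = cong inj₂ (l-inj i j eq)

    h-adj : ∀ k k′ → h k E**.~ h k′ ⇔ SimpleGraph._~_ (K 1 3) k k′
    h-adj (inj₁ zero) (inj₁ zero) = mk⇔ (λ (x≉x , _) → ⊥-elim (x≉x refl)) λ ()
    h-adj (inj₁ zero) (inj₂ i)    = mk⇔ (λ _ → left-right zero i)
      (λ _ → x≉l i , cocyclic⇒generateCyclic (adj i))
    h-adj (inj₂ i)    (inj₁ zero) = mk⇔ (λ _ → right-left zero i)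
      (λ _ → x≉l i ∘ sym , cocyclic⇒generateCyclic (cocyclic-sym (adj i)))
    h-adj (inj₂ i)    (inj₂ j)    = mk⇔
      (λ (li≉lj , gc) → ⊥-elim (indep i j (λ { ≡.refl → li≉lj refl }) (generateCyclic⇒cocyclic gc))) λ ()

  ¬claw⇒clawFree : ¬ Claw Cocyclic → ClawFree (properEnhancedPowerGraph (group F))
  ¬claw⇒clawFree ¬claw = noK₁₃⇒clawFree (properEnhancedPowerGraph (group F)) λ h h-inj h-adj →
    ¬claw ( proj₁ (h (inj₁ zero)) , proj₁ ∘ h ∘ inj₂
          , (λ i → generateCyclic⇒cocyclic
              (proj₂ (Equivalence.from (h-adj (inj₁ zero) (inj₂ i)) (left-right zero i))))
          , (λ i j i≢j coc → leaves (Equivalence.to (h-adj (inj₂ i) (inj₂ j))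
              ((λ eq → i≢j (inj₂-injective (h-inj {inj₂ i} {inj₂ j} eq))) , cocyclic⇒generateCyclic coc)))
          , proj₂ (h (inj₁ zero)) ∘ ⇒dominating )
    where
    leaves : ∀ {i j} → ¬ BipartiteAdj 1 3 (inj₂ i) (inj₂ j)
    leaves ()

-- Torsion in finite nilpotent groups

module Nilpotent {c ℓ} (F : FiniteGroup c ℓ) (nilpotent : IsNilpotent (group F)) where
  open Group (group F)
  open Powers (group F)
  open import Algebra.Properties.Group (group F) using (⁻¹-involutive; x∙y⁻¹≈ε⇒x≈y; //-rightDividesˡ)
  open Finite F
  open Cyclicity F
  open import Relation.Binary.Reasoning.Setoid setoid

  -- If γᵢ₊₁ lies in Q then γᵢ normalises Q, hence also lies in Q.
  selfNormalising⇒whole : ∀ {q} {Q : Carrier → Set q} → IsSubmonoid Q →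
    (∀ g → (∀ x → Q x → Q (conj g x)) → Q g) → ∀ g → Q g
  selfNormalising⇒whole {Q = Q} sub norm =
    descend (proj₁ nilpotent) λ g g∈ → ≈∈ (sym (proj₂ nilpotent g∈)) ε∈
    where
    open IsSubmonoid sub

    lowerCentral-⁻¹ : ∀ i {g} → lowerCentral (group F) i g → lowerCentral (group F) i (g ⁻¹)
    lowerCentral-⁻¹ zero    _  = _
    lowerCentral-⁻¹ (suc i) g∈ = inv g∈

    descend : ∀ i → (∀ g → lowerCentral (group F) i g → Q g) → ∀ g → Q g
    descend zero    γ⊆Q g = γ⊆Q g _
    descend (suc i) γ⊆Q   = descend i λ g g∈ → norm g λ x qx →
      -- The conjugate `g x g⁻¹` is the commutator of `g⁻¹` and `x⁻¹`, a generator of the next term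
      -- of the lower central series, times `x`.
      ≈∈ (begin
          (g ⁻¹) ⁻¹ ∙ (x ⁻¹) ⁻¹ ∙ g ⁻¹ ∙ x ⁻¹ ∙ x  ≈⟨ //-rightDividesˡ x _ ⟩
          (g ⁻¹) ⁻¹ ∙ (x ⁻¹) ⁻¹ ∙ g ⁻¹             ≈⟨ ∙-congʳ (∙-cong (⁻¹-involutive g) (⁻¹-involutive x)) ⟩
          g ∙ x ∙ g ⁻¹                             ∎)
        (∙∈ (γ⊆Q _ (gen (g ⁻¹ , x ⁻¹ , lowerCentral-⁻¹ i g∈ , refl))) qx)

  -- The last component controls the order: it later makes the torsion group of a prime power a
  -- p-group, of order coprime to the complement.
  TorsionSubgroup : ℕ → Set (c ⊔ ℓ)
  TorsionSubgroup m = Σ Subgroup λ H → let open Subgroup H in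
    (∀ {x} → ∈ x → x ^ m ≈ ε) × (∀ {x} → x ^ m ≈ ε → ∈ x) × (∃ λ k → size ∣ m ℕ.^ k)

  module _ {m n} (mn≡order : m * n ≡ order F) (cop : Coprime m n) where

    ^-mn : ∀ x → x ^ (m * n) ≈ ε
    ^-mn x = trans (^-congʳ x mn≡order) (^-order x)

    private
      module _ (H : Subgroup) where
        open Subgroup H

        -- Collecting the factors `g` on the right puts `(h ∙ g) ^ m` into `H`, so its `m`-th power
        -- is trivial. Its `n`-th power is trivial because `m * n` is the group order, and
        -- coprimality finishes.
        torsion-extends : (∀ {x} → ∈ x → x ^ m ≈ ε) → ∀ {h g} → Normalises g → g ^ m ≈ ε →
                          ∈ h → (h ∙ g) ^ m ≈ ε
        torsion-extends H-tors {h} {g} g-norm g^m≈ε h∈ with collect m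
          where
          collect : ∀ i → ∃ λ h′ → ∈ h′ × (h ∙ g) ^ i ≈ h′ ∙ g ^ i
          collect zero = ε , ε∈ , sym (identityˡ ε)
          collect (suc i) with collect i
          ... | h′ , h′∈ , eq = h ∙ conj g h′ , ∙∈ h∈ (g-norm h′ h′∈) , (begin
            h ∙ g ∙ (h ∙ g) ^ i           ≈⟨ ∙-congˡ eq ⟩
            h ∙ g ∙ (h′ ∙ g ^ i)          ≈⟨ assoc _ _ _ ⟩
            h ∙ (g ∙ (h′ ∙ g ^ i))        ≈⟨ ∙-congˡ (assoc _ _ _) ⟨
            h ∙ (g ∙ h′ ∙ g ^ i)          ≈⟨ ∙-congˡ (∙-congʳ (conj-move g h′)) ⟨
            h ∙ (conj g h′ ∙ g ∙ g ^ i)   ≈⟨ ∙-congˡ (assoc _ _ _) ⟩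
            h ∙ (conj g h′ ∙ (g ∙ g ^ i)) ≈⟨ assoc _ _ _ ⟨
            h ∙ conj g h′ ∙ (g ∙ g ^ i)   ∎)
        ... | h′ , h′∈ , eq = ^-coprime cop
          (trans (^-congˡ m (trans eq (trans (∙-congˡ g^m≈ε) (identityʳ h′)))) (H-tors h′∈))
          (trans (sym (^-* (h ∙ g) m n)) (^-mn (h ∙ g)))

        -- If no m-torsion element outside H normalises H, then N(N(H)) = N(H), so H is normal.
        saturated : (∀ {x} → ∈ x → x ^ m ≈ ε) →
                    ¬ (∃ λ x → x ^ m ≈ ε × ¬ ∈ x × Normalises x) → ∀ {x} → x ^ m ≈ ε → ∈ x
        saturated H-tors none {x} x^m = decidable-stable (∈? x) λ x∉ → none (x , x^m , x∉ , normal x)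
          where
          normal : ∀ g → Normalises g
          -- If `g` normalises `N(H)` and `y` lies in `H`, then `conj g y` is an `m`-torsion element
          -- of `N(H)`, hence lies in `H`. So `g` itself normalises `H`.
          normal = selfNormalising⇒whole normaliser λ g g-norm y y∈ →
            decidable-stable (∈? (conj g y)) λ ∉ → none
              ( conj g y
              , trans (conj-^ g y m) (trans (conj-cong g (H-tors y∈)) (conj-ε g))
              , ∉
              , g-norm y λ z z∈ → ∙∈ (∙∈ y∈ z∈) (⁻¹∈ isSubmonoid y∈) )

      -- Adjoining a normalising `m`-torsion element outside `H` keeps all elements `m`-torsion and
      -- strictly increases the size, which `order F` bounds. The new index divides `m` because
      -- `x ^ m` lies in `H`.
      enlarge : ∀ fuel (H : Subgroup) → let open Subgroup H in order F < fuel + size →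
                (∀ {x} → ∈ x → x ^ m ≈ ε) → (∃ λ k → size ∣ m ℕ.^ k) → TorsionSubgroup m
      enlarge fuel H N< H-tors size∣ with search
          (λ x≈y (x^m , x∉ , x-norm) → trans (^-congˡ m (sym x≈y)) x^m
            , x∉ ∘ Subgroup.≈∈ H (sym x≈y) , IsSubmonoid.≈∈ (Subgroup.normaliser H) x≈y x-norm)
          (λ x → (x ^ m ≟ ε) ×-dec (¬? (Subgroup.∈? H x) ×-dec Subgroup.normalises? H x))
      ... | no none = H , H-tors , saturated H H-tors none , size∣
      enlarge zero H N< _ _ | yes _ = ⊥-elim (<-irrefl ≡.refl (<-≤-trans N< (Subgroup.size≤order H)))
      enlarge (suc fuel) H N< H-tors (k , size∣m^k) | yes (x , x^m , x∉ , x-norm) =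
        enlarge fuel extended N<′ K-tors (suc k , size∣)
        where
        module H = Subgroup H
        open Extension (extend H x x-norm)
        module K = Subgroup extended

        size∣ : K.size ∣ m ℕ.^ suc k
        size∣ = subst (_∣ m * m ℕ.^ k) (≡.sym size≡)
          (*-pres-∣ (minimal m (H.≈∈ (sym x^m) H.ε∈)) size∣m^k)

        index≥2 : ∀ d → K.size ≡ d * H.size → H.∈ x ^ d → 2 ≤ d
        index≥2 0 eq _ = ⊥-elim (<-irrefl (≡.sym eq) K.0<size)
        index≥2 1 _ x∈ = ⊥-elim (x∉ (H.≈∈ (^1 x) x∈))
        index≥2 (suc (suc d)) _ _ = s≤s (s≤s z≤n)

        size< : H.size < K.size
        size< = subst (H.size <_) (≡.trans (*-comm H.size index′) (≡.sym size≡))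
          (m<m*n H.size index′ {{>-nonZero H.0<size}} (index≥2 index′ size≡ x^index∈))

        N<′ : order F < fuel + K.size
        N<′ = ≤-trans N< (subst (_≤ fuel + K.size) (+-suc fuel H.size) (+-monoʳ-≤ fuel size<))

        K-tors : ∀ {y} → K.∈ y → y ^ m ≈ ε
        K-tors y∈ with ∈⇒ y∈
        ... | h , j , h∈ , eq = trans (^-congˡ m (sym eq))
          (torsion-extends H H-tors (IsSubmonoid.^∈ H.normaliser j x-norm) (^≈ε-^ {m = m} j x^m) h∈)

    torsionSubgroup : TorsionSubgroup m
    torsionSubgroup = enlarge (suc (order F)) trivial (s≤s (m≤m+n (order F) 1))
      (λ (_ , eq) → trans (^-congˡ m (sym eq)) (ε^ m)) (0 , ∣-refl)

    torsion-submonoid : IsSubmonoid (λ x → x ^ m ≈ ε)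
    torsion-submonoid with torsionSubgroup
    ... | H , ⇒tors , tors⇒ , _ = record
      { ≈∈ = λ x≈y → trans (^-congˡ m (sym x≈y))
      ; ε∈ = ε^ m
      ; ∙∈ = λ xm ym → ⇒tors (Subgroup.∙∈ H (tors⇒ xm) (tors⇒ ym))
      }

  -- Projections for a coprime factorisation of the order

  module CoprimeSplit {m n} (mn≡order : m * n ≡ order F) (cop : Coprime m n) where
    private
      mᵗ = torsion-submonoid mn≡order cop
      nᵗ = torsion-submonoid (≡.trans (*-comm n m) mn≡order) (Coprimality.sym cop)

    private
      idem : Idempotents m n
      idem = idempotents {{subst NonZero (≡.sym mn≡order) order≢0}} cop

    open Idempotents idem public

    -- The torsion subgroups are normal, so x y x⁻¹ y⁻¹ lies in both.
    torsion-commute : ∀ {x y} → x ^ m ≈ ε → y ^ n ≈ ε → x ∙ y ≈ y ∙ x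
    torsion-commute {x} {y} xm yn =
      trans (sym (conj-move x y)) (∙-congʳ (x∙y⁻¹≈ε⇒x≈y _ _ (^-coprime cop m-tors n-tors)))
      where
      conj-tors : ∀ g {z} k → z ^ k ≈ ε → conj g z ^ k ≈ ε
      conj-tors g {z} k zk = trans (conj-^ g z k) (trans (conj-cong g zk) (conj-ε g))
      n-tors : (conj x y ∙ y ⁻¹) ^ n ≈ ε
      n-tors = IsSubmonoid.∙∈ nᵗ (conj-tors x n yn) (⁻¹∈ nᵗ yn)
      m-tors : (conj x y ∙ y ⁻¹) ^ m ≈ ε
      m-tors = IsSubmonoid.≈∈ mᵗ
        (trans (sym (assoc _ _ _)) (∙-congʳ (sym (assoc _ _ _))))
        (IsSubmonoid.∙∈ mᵗ xm (conj-tors y m (⁻¹∈ mᵗ xm)))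

    e-torsion : ∀ x → (x ^ e) ^ m ≈ ε
    e-torsion x = trans (sym (^-* x e m)) (^≈ε-∣ (^-order x)
      (subst (_∣ e * m) (≡.trans (*-comm n m) mn≡order) (*-pres-∣ n∣e ∣-refl)))

    f-torsion : ∀ x → (x ^ f) ^ n ≈ ε
    f-torsion x = trans (sym (^-* x f n)) (^≈ε-∣ (^-order x)
      (subst (_∣ f * n) mn≡order (*-pres-∣ m∣f ∣-refl)))

    join : ∀ x → x ^ e ∙ x ^ f ≈ x
    join x = trans (sym (^-+ x e f)) (trans (^-congʳ x e+f≡1) (^-≡1 k (^-mn mn≡order cop x)))

    e-kill : ∀ {x} → x ^ n ≈ ε → x ^ e ≈ ε
    e-kill xn = ^≈ε-∣ xn n∣e

    f-kill : ∀ {x} → x ^ m ≈ ε → x ^ f ≈ ε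
    f-kill xm = ^≈ε-∣ xm m∣f

    e-fix : ∀ {x} → x ^ m ≈ ε → x ^ e ≈ x
    e-fix = ^-e-fix idem

    f-fix : ∀ {x} → x ^ n ≈ ε → x ^ f ≈ x
    f-fix = ^-f-fix idem

    e-pair : ∀ {u v} → u ^ m ≈ ε → v ^ n ≈ ε → (u ∙ v) ^ e ≈ u
    e-pair um vn = trans (∙-^ e (torsion-commute um vn))
      (trans (∙-cong (e-fix um) (e-kill vn)) (identityʳ _))

    f-pair : ∀ {u v} → u ^ m ≈ ε → v ^ n ≈ ε → (u ∙ v) ^ f ≈ v
    f-pair um vn = trans (∙-^ f (torsion-commute um vn))
      (trans (∙-cong (f-kill um) (f-fix vn)) (identityˡ _))

    private
      regroup : ∀ x y → x ∙ y ≈ (x ^ e ∙ y ^ e) ∙ (x ^ f ∙ y ^ f)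
      regroup x y = trans (∙-cong (sym (join x)) (sym (join y)))
        (interchange (x ^ e) (y ^ f) (sym (torsion-commute (e-torsion y) (f-torsion x))))

    -- Although the group may be non-abelian, commuting torsion parts regroup `x ∙ y` into an
    -- `m`-torsion factor times an `n`-torsion factor, and the `e`-th power keeps the first.
    e-∙ : ∀ x y → (x ∙ y) ^ e ≈ x ^ e ∙ y ^ e
    e-∙ x y = trans (^-congˡ e (regroup x y)) (e-pair
      (IsSubmonoid.∙∈ mᵗ (e-torsion x) (e-torsion y)) (IsSubmonoid.∙∈ nᵗ (f-torsion x) (f-torsion y)))

    f-∙ : ∀ x y → (x ∙ y) ^ f ≈ x ^ f ∙ y ^ f
    f-∙ x y = trans (^-congˡ f (regroup x y)) (f-pair
      (IsSubmonoid.∙∈ mᵗ (e-torsion x) (e-torsion y)) (IsSubmonoid.∙∈ nᵗ (f-torsion x) (f-torsion y)))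

    -- The commuting projections of the two given roots multiply to a common root; the exponents
    -- come from the Chinese remainder theorem.
    cocyclic-join : ∀ {x y} → Cocyclic (x ^ e) (y ^ e) → Cocyclic (x ^ f) (y ^ f) → Cocyclic x y
    cocyclic-join {x} {y} (g , (i , gi) , (j , gj)) (h , (i′ , hi′) , (j′ , hj′)) =
      r , (e * i + f * i′ , power {x} gi hi′) , (e * j + f * j′ , power {y} gj hj′)
      where
      r = g ^ e ∙ h ^ f
      power : ∀ {z i i′} → g ^ i ≈ z ^ e → h ^ i′ ≈ z ^ f → r ^ (e * i + f * i′) ≈ z
      power {z} {i} {i′} gi hi′ = begin
        (g ^ e ∙ h ^ f) ^ (e * i + f * i′)
          ≈⟨ ∙-^ (e * i + f * i′) (torsion-commute (e-torsion g) (f-torsion h)) ⟩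
        (g ^ e) ^ (e * i + f * i′) ∙ (h ^ f) ^ (e * i + f * i′)
          ≈⟨ ∙-cong (^-crtˡ idem i i′ (e-torsion g)) (^-crtʳ idem i i′ (f-torsion h)) ⟩
        (g ^ e) ^ i ∙ (h ^ f) ^ i′   ≈⟨ ∙-cong (^-swap g e i) (^-swap h f i′) ⟩
        (g ^ i) ^ e ∙ (h ^ i′) ^ f   ≈⟨ ∙-cong (trans (^-congˡ e gi) (e-fix (e-torsion z)))
                                              (trans (^-congˡ f hi′) (f-fix (f-torsion z))) ⟩
        z ^ e ∙ z ^ f                ≈⟨ join z ⟩
        z                            ∎

    -- In each torsion component one of the two elements is trivial.
    cocyclic-coprime : ∀ {x y} → x ^ m ≈ ε → y ^ n ≈ ε → Cocyclic y x
    cocyclic-coprime xm yn = cocyclic-join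
      (cocyclic-resp (sym (e-kill yn)) refl (cocyclic-ε _))
      (cocyclic-resp refl (sym (f-kill xm)) (cocyclic-sym (cocyclic-ε _)))

  -- Cyclic torsion, or a pair without a common root

  TorsionCyclic : ℕ → Set (c ⊔ ℓ)
  TorsionCyclic m = ∃ λ g → g ^ m ≈ ε × (∀ {x} → x ^ m ≈ ε → ∃ λ i → g ^ i ≈ x)

  NonCocyclicTorsion : ℕ → Set (c ⊔ ℓ)
  NonCocyclicTorsion m = ∃₂ λ a b → a ^ m ≈ ε × b ^ m ≈ ε × ¬ Cocyclic a b

  module _ {m n} (mn≡order : m * n ≡ order F) (cop : Coprime m n) where
    open CoprimeSplit mn≡order cop

    private
      GeneratorOf : ∀ {s} → (Fin s → Carrier) → Set (c ⊔ ℓ)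
      GeneratorOf t = ∃ λ g → g ^ m ≈ ε × (∀ i → ∃ λ j → g ^ j ≈ t i)

      torsion-root : ∀ {g x} k → g ^ k ≈ x → x ^ m ≈ ε → (g ^ e) ^ k ≈ x
      torsion-root {g} k gk xm = trans (^-swap g e k) (trans (^-congˡ e gk) (e-fix xm))

      insert : ∀ {s} (t : Fin (suc s) → Carrier) → t zero ^ m ≈ ε → (root : GeneratorOf (t ∘ suc)) →
               Cocyclic (proj₁ root) (t zero) → GeneratorOf t
      -- The common root `r` may have an `n`-torsion part; `r ^ e` removes it and is still a root of
      -- the `m`-torsion elements.
      insert t t₀m (g , gm , all) (r , (i , ri) , (j , rj)) = r ^ e , e-torsion r , λ
        { zero    → j , torsion-root j rj t₀m
        ; (suc l) → let k , gk = all l in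
            i * k , trans (^-* (r ^ e) i k) (trans (^-congˡ k (torsion-root i ri gm)) gk) }

      -- One root of the elements seen so far is maintained along the list. Either it shares a root
      -- with the next element, or the two form the required pair.
      generator : ∀ {s} (t : Fin s → Carrier) → (∀ i → t i ^ m ≈ ε) →
                  GeneratorOf t ⊎ NonCocyclicTorsion m
      generator {zero}  t tors = inj₁ (ε , ε^ m , λ ())
      generator {suc s} t tors = add (generator (t ∘ suc) (tors ∘ suc))
        where
        add : GeneratorOf (t ∘ suc) ⊎ NonCocyclicTorsion m → GeneratorOf t ⊎ NonCocyclicTorsion m
        add (inj₂ pair) = inj₂ pair
        add (inj₁ root@(g , gm , _)) = decide (cocyclic? g (t zero))
          where
          decide : Dec (Cocyclic g (t zero)) → GeneratorOf t ⊎ NonCocyclicTorsion m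
          decide (yes coc) = inj₁ (insert t (tors zero) root coc)
          decide (no ¬coc) = inj₂ (g , t zero , gm , tors zero , ¬coc)

    torsionCyclic⊎nonCocyclic : TorsionCyclic m ⊎ NonCocyclicTorsion m
    torsionCyclic⊎nonCocyclic = let H , ⇒tors , tors⇒ , _ = torsionSubgroup mn≡order cop in
      map₁ (λ (g , gm , all) → g , gm , λ xm → let i , eq = tors⇒ xm ; j , gj = all i in j , trans gj eq)
        (generator (Subgroup.elem H) (λ i → ⇒tors (i , refl)))

  PrimaryPair : Set (c ⊔ ℓ)
  PrimaryPair = ∃ λ p → ∃₂ λ v n → Prime p × p ℕ.^ v * n ≡ order F ×
    Coprime (p ℕ.^ v) n × NonCocyclicTorsion (p ℕ.^ v)

  -- Strong induction on `n`: split off the full power `q` of a prime dividing `n`. If the `q`-parts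
  -- of the pair have a common root, the complementary parts have none, and they are torsion for the
  -- smaller `n′`.
  primaryPair : ∀ n m → m * n ≡ order F → Coprime m n → NonCocyclicTorsion n → PrimaryPair
  primaryPair = <-rec (λ n → ∀ m → m * n ≡ order F → Coprime m n → NonCocyclicTorsion n → PrimaryPair) step
    where
    step : ∀ n → (∀ {k} → k < n → ∀ m → m * k ≡ order F → Coprime m k → NonCocyclicTorsion k → PrimaryPair) →
           ∀ m → m * n ≡ order F → Coprime m n → NonCocyclicTorsion n → PrimaryPair
    step n rec m mn≡ cop (a , b , an , bn , ¬ab)
      with n≢0 ← m*n≢0⇒n≢0 m {{subst NonZero (≡.sym mn≡) order≢0}}
      with primeDivisor n {{n≢0}} n≢1
      where
      n≢1 : ¬ n ≡ 1
      n≢1 ≡.refl = ¬ab (cocyclic-resp (sym (trans (sym (^1 a)) an)) refl (cocyclic-ε b))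
    ... | p , p-prime , p∣n with primePart p-prime n {{n≢0}}
    ...   | v , n′ , n≡ , p∤n′ = conclude (cocyclic? (a ^ e) (b ^ e)) (cocyclic? (a ^ f) (b ^ f))
      where
      q = p ℕ.^ v

      q∣n : q ∣ n
      q∣n = subst (q ∣_) (≡.sym n≡) (m∣m*n n′)
      n′∣n : n′ ∣ n
      n′∣n = subst (n′ ∣_) (≡.sym n≡) (n∣m*n q)
      cop-qn′ : Coprime q n′
      cop-qn′ = coprime-^ˡ v (prime∤⇒coprime p-prime p∤n′)
      cop-mq : Coprime m q
      cop-mq (d∣m , d∣q) = cop (d∣m , ∣-trans d∣q q∣n)
      cop-mn′ : Coprime m n′
      cop-mn′ (d∣m , d∣n′) = cop (d∣m , ∣-trans d∣n′ n′∣n)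
      cop-split : Coprime q (m * n′)
      cop-split = Coprimality.sym (coprime-*ˡ cop-mq (Coprimality.sym cop-qn′))
      split≡ : q * (m * n′) ≡ order F
      split≡ = ≡.trans (≡.sym (*-assoc q m n′)) (≡.trans (cong (_* n′) (*-comm q m))
        (≡.trans (*-assoc m q n′) (≡.trans (cong (m *_) (≡.sym n≡)) mn≡)))

      open CoprimeSplit split≡ cop-split

      n′<n : n′ < n
      n′<n = subst (n′ <_) (≡.trans (*-comm n′ q) (≡.sym n≡)) (m<m*n n′ q {{n′≢0}} (1<q v ≡.refl))
        where
        n′≢0 = m*n≢0⇒n≢0 q {{subst NonZero n≡ n≢0}}
        1<q : ∀ w → w ≡ v → 1 < p ℕ.^ w
        1<q zero    0≡v = ⊥-elim (p∤n′ (subst (p ∣_)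
          (≡.trans n≡ (≡.trans (cong (λ w → p ℕ.^ w * n′) (≡.sym 0≡v)) (*-identityˡ n′))) p∣n))
        1<q (suc w) _ = <-≤-trans (nonTrivial⇒n>1 p {{prime⇒nonTrivial p-prime}})
          (m≤m*n p (p ℕ.^ w) {{m^n≢0 p w {{nonTrivial⇒nonZero p {{prime⇒nonTrivial p-prime}}}}}})

      -- The element `(x ^ f) ^ n′` is killed both by `m` and by `q`, which are coprime.
      f-torsion′ : ∀ {x} → x ^ n ≈ ε → (x ^ f) ^ n′ ≈ ε
      f-torsion′ {x} xn = ^-coprime cop-mq
        (trans (sym (^-* (x ^ f) n′ m)) (trans (^-congʳ _ (*-comm n′ m)) (f-torsion x)))
        (trans (sym (^-* (x ^ f) n′ q)) (trans (^-congʳ _ (≡.trans (*-comm n′ q) (≡.sym n≡))) (^≈ε-^ {m = n} f xn)))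

      conclude : Dec (Cocyclic (a ^ e) (b ^ e)) → Dec (Cocyclic (a ^ f) (b ^ f)) → PrimaryPair
      conclude (no ¬e) _ = p , v , m * n′ , p-prime , split≡ , cop-split
        , a ^ e , b ^ e , e-torsion a , e-torsion b , ¬e
      conclude (yes ye) (yes yf) = ⊥-elim (¬ab (cocyclic-join ye yf))
      conclude (yes _)  (no ¬f)  = rec n′<n (m * q)
        (≡.trans (*-assoc m q n′) (≡.trans (cong (m *_) (≡.sym n≡)) mn≡))
        (coprime-*ˡ cop-mn′ cop-qn′)
        (a ^ f , b ^ f , f-torsion′ an , f-torsion′ bn , ¬f)

  nonCyclic⇒primaryPair : ¬ IsCyclic (group F) → PrimaryPair
  -- For the factorisation `order F * 1` every element is torsion.
  nonCyclic⇒primaryPair ¬cyc with torsionCyclic⊎nonCocyclic (*-identityʳ (order F)) (Coprimality.sym (1-coprimeTo (order F)))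
  ... | inj₁ (g , _ , all) = ⊥-elim (¬cyc (isCyclic g λ x → all (^-order x)))
  ... | inj₂ pair = primaryPair (order F) 1 (*-identityˡ (order F)) (1-coprimeTo (order F)) pair

  -- For a, b not powers of a common element, a, b and ab generate the same
  -- non-cyclic group pairwise; they are the leaves, and an element of coprime
  -- order is the centre.
  twoNonCocyclic⇒claw : ∀ {m n} → m * n ≡ order F → Coprime m n →
    NonCocyclicTorsion m → NonCocyclicTorsion n → Claw Cocyclic
  twoNonCocyclic⇒claw {m} mn≡ cop (a , b , am , bm , ¬ab) (a′ , b′ , a′n , _ , ¬a′b′) =
    a′ , leaf , (λ i → cocyclic-coprime (leaf-torsion i) a′n) , independent , λ all → ¬a′b′ (all b′)
    where
    open CoprimeSplit mn≡ cop
    leaf : Fin 3 → Carrier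
    leaf zero             = a
    leaf (suc zero)       = b
    leaf (suc (suc zero)) = a ∙ b

    leaf-torsion : ∀ i → leaf i ^ m ≈ ε
    leaf-torsion zero             = am
    leaf-torsion (suc zero)       = bm
    leaf-torsion (suc (suc zero)) = IsSubmonoid.∙∈ (torsion-submonoid mn≡ cop) am bm

    ¬a-ab : ¬ Cocyclic a (a ∙ b)
    ¬a-ab (g , a∈ , ab∈) = ¬ab (g , a∈ , cancelˡ∈ (powers-submonoid g) a∈ ab∈)

    ¬b-ab : ¬ Cocyclic b (a ∙ b)
    ¬b-ab (g , b∈ , ab∈) = ¬ab (g , cancelʳ∈ (powers-submonoid g) b∈ ab∈ , b∈)

    independent : ∀ i j → ¬ i ≡ j → ¬ Cocyclic (leaf i) (leaf j)
    independent zero             zero             i≢j = ⊥-elim (i≢j ≡.refl)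
    independent zero             (suc zero)       i≢j = ¬ab
    independent zero             (suc (suc zero)) i≢j = ¬a-ab
    independent (suc zero)       zero             i≢j = ¬ab ∘ cocyclic-sym
    independent (suc zero)       (suc zero)       i≢j = ⊥-elim (i≢j ≡.refl)
    independent (suc zero)       (suc (suc zero)) i≢j = ¬b-ab
    independent (suc (suc zero)) zero             i≢j = ¬a-ab ∘ cocyclic-sym
    independent (suc (suc zero)) (suc zero)       i≢j = ¬b-ab ∘ cocyclic-sym
    independent (suc (suc zero)) (suc (suc zero)) i≢j = ⊥-elim (i≢j ≡.refl)

-- Products with a coprime cyclic factor

module _ {c ℓ c′ ℓ′} (G : Group c ℓ) (H : Group c′ ℓ′) where
  open Powers G using () renaming (_^_ to _^ᴳ_)
  open Powers H using () renaming (_^_ to _^ᴴ_)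
  open Powers (G ×ᴳ H) using () renaming (_^_ to _^ˣ_)

  ×-^ : ∀ z k → z ^ˣ k ≡ (proj₁ z ^ᴳ k , proj₂ z ^ᴴ k)
  ×-^ z zero    = ≡.refl
  ×-^ z (suc k) = cong (Group._∙_ (G ×ᴳ H) z) (×-^ z k)

module _ (n : ℕ) .{{_ : NonZero n}} where
  open Powers (group (C n))

  toℕ-∙ : ∀ i j → toℕ (Group._∙_ (group (C n)) i j) ≡ (toℕ i + toℕ j) % n
  toℕ-∙ i j = toℕ-fromℕ< (m%n<n (toℕ i + toℕ j) n)

  toℕ-1^ : ∀ k → toℕ ((1 mod n) ^ k) ≡ k % n
  toℕ-1^ zero    = toℕ-fromℕ< (m%n<n 0 n)
  toℕ-1^ (suc k) = ≡.trans (toℕ-∙ (1 mod n) ((1 mod n) ^ k))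
    (≡.trans (cong₂ (λ i j → (i + j) % n) (toℕ-fromℕ< (m%n<n 1 n)) (toℕ-1^ k))
             (≡.sym (%-distribˡ-+ 1 k n)))

  C-generated : ∀ j → ∃ λ i → (1 mod n) ^ i ≡ j
  C-generated j = toℕ j , toℕ-injective (≡.trans (toℕ-1^ (toℕ j)) (m<n⇒m%n≡m (toℕ<n j)))

module CyclicFactor {a ℓ b ℓ′} (F : FiniteGroup a ℓ) (P : FiniteGroup b ℓ′) (n : ℕ) {{n≢0 : NonZero n}}
                    (cop : Coprime (order P) n)
                    (iso : group F ≅ᴳ (group P ×ᴳ group (C n))) where
  private
    module F where
      open Group (group F) public
      open Powers (group F) public
    module P where
      open Group (group P) public
      open Powers (group P) public
    Q = group P ×ᴳ group (C n)
    module Q where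
      open Group Q public
      open Powers Q public
    to = proj₁ iso
  open IsGroupIsomorphism (proj₂ iso)
  open IsGroupHomomorphism isGroupHomomorphism using (homo)

  φ : F.Carrier → P.Carrier
  φ x = proj₁ (to x)

  φ-hom : IsGroupHomomorphism F.rawGroup P.rawGroup φ
  φ-hom = ∙-homo⇒groupHomomorphism (group F) (group P) (proj₁ ∘ ⟦⟧-cong) (λ x y → proj₁ (homo x y))

  φ⁻ : P.Carrier → F.Carrier
  φ⁻ y = proj₁ (surjective (y , Group.ε (group (C n))))

  φ-φ⁻ : ∀ y → φ (φ⁻ y) P.≈ y
  φ-φ⁻ y = proj₁ (proj₂ (surjective (y , _)) F.refl)

  cocyclic⇒φ : ∀ x y → F.Cocyclic x y → P.Cocyclic (φ x) (φ y)
  cocyclic⇒φ x y = homo-cocyclic (group F) (group P) φ-hom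

  -- A root `g` in `P` is paired with the generator 1 of `C n`. An exponent congruent to `i` modulo
  -- `order P` and to `i′` modulo `n` then hits both components.
  φ⇒cocyclic : ∀ x y → P.Cocyclic (φ x) (φ y) → F.Cocyclic x y
  φ⇒cocyclic x y (g , (i , gi) , (j , gj)) = u , root i gi , root j gj
    where
    instance
      Pn≢0 : NonZero (order P * n)
      Pn≢0 = m*n≢0 (order P) n {{Cyclicity.order≢0 P}}
    idem = idempotents cop
    open Idempotents idem using (e; f)
    r = g , 1 mod n
    u = proj₁ (surjective r)

    root : ∀ {z} i → g P.^ i P.≈ φ z → ∃ λ l → u F.^ l F.≈ z
    root {z} i gi with C-generated n (proj₂ (to z))
    ... | i′ , eq = e * i + f * i′ , injective (Q.trans (homo-^ (group F) Q isGroupHomomorphism u (e * i + f * i′))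
      (Q.trans (Q.^-congˡ (e * i + f * i′) (proj₂ (surjective r) F.refl))
      (Q.trans (Q.reflexive (×-^ (group P) (group (C n)) r (e * i + f * i′)))
        ( P.trans (Powers.^-crtˡ (group P) idem i i′ (Finite.^-order P g)) gi
        , ≡.trans (Powers.^-crtʳ (group (C n)) idem {1 mod n} i i′ (Finite.^-order (C n) (1 mod n))) eq))))

  claw⇒φ : Claw F.Cocyclic → Claw P.Cocyclic
  claw⇒φ = claw-map φ cocyclic⇒φ φ⇒cocyclic

  φ⇒claw : Claw P.Cocyclic → Claw F.Cocyclic
  φ⇒claw = claw-map φ⁻
    (λ x y coc → φ⇒cocyclic _ _ (P.cocyclic-resp (P.sym (φ-φ⁻ x)) (P.sym (φ-φ⁻ y)) coc))
    (λ x y coc → P.cocyclic-resp (φ-φ⁻ x) (φ-φ⁻ y) (cocyclic⇒φ _ _ coc))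

-- Splitting off a cyclic torsion factor

module Decomposition {c ℓ} (F : FiniteGroup c ℓ) (nilpotent : IsNilpotent (group F))
                     {m n} (mn≡ : m * n ≡ order F) (cop : Coprime m n) where
  open Group (group F)
  open Powers (group F)
  open Finite F
  open Cyclicity F
  open Nilpotent F nilpotent
  open CoprimeSplit mn≡ cop
  open import Algebra.Properties.Group (group F) using (identityʳ-unique)

  private
    torsionˢ : TorsionSubgroup m
    torsionˢ = torsionSubgroup mn≡ cop
    module T = Subgroup (proj₁ torsionˢ)

    ∈T : ∀ x → T.∈ (x ^ e)
    ∈T x = proj₁ (proj₂ (proj₂ torsionˢ)) (e-torsion x)

    e-elem : ∀ i → T.elem i ^ e ≈ T.elem i
    e-elem i = e-fix (proj₁ (proj₂ torsionˢ) (i , refl))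

    e-homomorphism : IsGroupHomomorphism rawGroup rawGroup (_^ e)
    e-homomorphism = ∙-homo⇒groupHomomorphism (group F) (group F) (^-congˡ e) e-∙

    -- With equality pulled back along the projection, injectivity holds by definition and the group
    -- laws transfer.
    e-monomorphism : IsGroupMonomorphism (record { Group (group F) ; _≈_ = λ x y → x ^ e ≈ y ^ e }) rawGroup (_^ e)
    e-monomorphism = record
      { isGroupHomomorphism = record
        { isMonoidHomomorphism = record
          { isMagmaHomomorphism = record
            { isRelHomomorphism = record { cong = λ eq → eq } ; homo = e-∙ }
          ; ε-homo = ε^ e
          }
        ; ⁻¹-homo = IsGroupHomomorphism.⁻¹-homo e-homomorphism
        }
      ; injective = λ eq → eq
      }

  -- The m-torsion subgroup, presented as the quotient of G by the kernel of
  -- the projection x ↦ xᵉ so that it keeps the carrier of G.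
  torsionGroup : FiniteGroup c ℓ
  torsionGroup = record
    { group = record
      { isGroup = GroupMonomorphism.isGroup e-monomorphism isGroup }
    ; order = T.size
    ; enumeration = record
      { to        = λ x → proj₁ (∈T x)
      ; from      = T.elem
      ; to-cong   = λ {x} {y} eq → T.elem-injective
          (trans (proj₂ (∈T x)) (trans eq (sym (proj₂ (∈T y)))))
      ; from-cong = λ { ≡.refl → refl }
      ; inverse   = (λ {i} {y} eq → T.elem-injective (trans (proj₂ (∈T y)) (trans eq (e-elem i))))
                  , (λ { {x} ≡.refl → trans (^-congˡ e (proj₂ (∈T x))) (e-fix (e-torsion x)) })
      }
    }

  torsionGroup-order : ∃ λ k → order torsionGroup ∣ m ℕ.^ k
  torsionGroup-order = proj₂ (proj₂ (proj₂ torsionˢ))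

  -- The cyclic factor is `C o` with `o` the order of the generator `g`; coprimality to the other
  -- factor follows from `o ∣ n`.
  module _ (g : Carrier) (gn : g ^ n ≈ ε) (generates : ∀ {x} → x ^ n ≈ ε → ∃ λ i → g ^ i ≈ x) where
    open ElementOrder (elementOrder g) public using () renaming (ord to cyclicOrder)
    open ElementOrder (elementOrder g) using (^-ord; ord∣)
    private o = cyclicOrder

    cyclicOrder∣n : o ∣ n
    cyclicOrder∣n = ord∣ n gn

    instance
      cyclicOrder≢0 : NonZero o
      cyclicOrder≢0 = ≢-nonZero λ o≡0 → ≢-nonZero⁻¹ n
        {{m*n≢0⇒n≢0 m {{subst NonZero (≡.sym mn≡) order≢0}}}}
        (0∣⇒≡0 (subst (_∣ n) o≡0 cyclicOrder∣n))

    private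
      ^-≤-injective : ∀ {i j} → i ≤ j → j < o → g ^ i ≈ g ^ j → i ≡ j
      ^-≤-injective {i} i≤j j<o eq with m≤n⇒∃[o]m+o≡n i≤j
      ... | zero  , ≡.refl = ≡.sym (+-identityʳ i)
      ... | suc d , ≡.refl = ⊥-elim (<⇒≱ j<o (≤-trans (∣⇒≤ (ord∣ (suc d)
              (identityʳ-unique (g ^ i) _ (trans (sym (^-+ g i (suc d))) (sym eq))))) (m≤n+m (suc d) i)))

      ^-injective : ∀ {i j : Fin o} → g ^ toℕ i ≈ g ^ toℕ j → i ≡ j
      ^-injective {i} {j} eq with ≤-total (toℕ i) (toℕ j)
      ... | inj₁ i≤j = toℕ-injective (^-≤-injective i≤j (toℕ<n j) eq)
      ... | inj₂ j≤i = toℕ-injective (≡.sym (^-≤-injective j≤i (toℕ<n i) (sym eq)))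

      -- The discrete logarithm to base `g` of the `n`-torsion part of `x`.
      log : Carrier → Fin o
      log x = proj₁ (generates (f-torsion x)) mod o

      ^-log : ∀ x → g ^ toℕ (log x) ≈ x ^ f
      ^-log x = let i , gi = generates (f-torsion x) in
        trans (^-congʳ g (toℕ-fromℕ< (m%n<n i o))) (trans (^-% i ^-ord) gi)

      log-unique : ∀ {x j} → g ^ toℕ j ≈ x ^ f → log x ≡ j
      log-unique {x} eq = ^-injective (trans (^-log x) (sym eq))

      log-∙ : ∀ x y → log (x ∙ y) ≡ Group._∙_ (group (C o)) (log x) (log y)
      log-∙ x y = log-unique (begin
        g ^ toℕ (Group._∙_ (group (C o)) (log x) (log y)) ≈⟨ ^-congʳ g (toℕ-∙ o (log x) (log y)) ⟩
        g ^ ((toℕ (log x) + toℕ (log y)) % o)             ≈⟨ ^-% (toℕ (log x) + toℕ (log y)) ^-ord ⟩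
        g ^ (toℕ (log x) + toℕ (log y))                   ≈⟨ ^-+ g (toℕ (log x)) (toℕ (log y)) ⟩
        g ^ toℕ (log x) ∙ g ^ toℕ (log y)                 ≈⟨ ∙-cong (^-log x) (^-log y) ⟩
        x ^ f ∙ y ^ f                                     ≈⟨ f-∙ x y ⟨
        (x ∙ y) ^ f                                       ∎)
        where open import Relation.Binary.Reasoning.Setoid setoid

    decompose : group F ≅ᴳ (group torsionGroup ×ᴳ group (C o))
    decompose = (λ x → x , log x) , record
      { isGroupMonomorphism = record
        { isGroupHomomorphism = ∙-homo⇒groupHomomorphism (group F) (group torsionGroup ×ᴳ group (C o))
            (λ {x} {y} x≈y → ^-congˡ e x≈y , log-unique (trans (^-log y) (^-congˡ f (sym x≈y))))
            (λ x y → refl , log-∙ x y)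
        ; injective = λ {x} {y} (eq , log≡) → trans (sym (join x)) (trans
            (∙-cong eq (trans (sym (^-log x)) (trans (^-congʳ g (cong toℕ log≡)) (^-log y)))) (join y))
        }
      -- Representatives `y` range over all of `G`, so `y` is projected to its `m`-torsion part
      -- before the power of `g` is attached.
      ; surjective = λ (y , j) → y ^ e ∙ g ^ toℕ j , λ {z} z≈ →
          trans (^-congˡ e z≈) (e-pair (e-torsion y) (^≈ε-^ {m = n} (toℕ j) gn))
        , log-unique (sym (trans (^-congˡ f z≈) (f-pair (e-torsion y) (^≈ε-^ {m = n} (toℕ j) gn))))
      }

-- Claw-freeness for non-cyclic nilpotent groups

corollary2p3 : ∀ {c ℓ} (G : FiniteGroup c ℓ) →
    ¬ IsCyclic (group G) →
    IsNilpotent (group G) →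
    ClawFree (properEnhancedPowerGraph (group G)) ⇔
    (Σ[ p ∈ ℕ ] Σ[ P ∈ FiniteGroup c ℓ ] Σ[ n ∈ ℕ ] Σ[ n≢0 ∈ NonZero n ]
    Prime p ×
    IsPGroup p P ×
    ¬ IsCyclic (group P) ×
    (group G ≅ᴳ (group P ×ᴳ group (C n {{n≢0}}))) ×
    gcd (order P) n ≡ 1 ×
    ClawFree (properEnhancedPowerGraph (group P)))
corollary2p3 G ¬cyclic nilpotent = mk⇔ split
  λ (p , P , n , n≢0 , _ , _ , _ , iso , gcd≡1 , P-free) →
    Cyclicity.¬claw⇒clawFree G (Cyclicity.clawFree⇒¬claw P P-free
      ∘ CyclicFactor.claw⇒φ G P n {{n≢0}} (gcd≡1⇒coprime gcd≡1) iso)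
  where
  open Nilpotent G nilpotent

  split : ClawFree (properEnhancedPowerGraph (group G)) → _
  split free with nonCyclic⇒primaryPair ¬cyclic
  ... | p , v , n , p-prime , qn≡ , cop , pair
    with torsionCyclic⊎nonCocyclic (≡.trans (*-comm n (p ℕ.^ v)) qn≡) (Coprimality.sym cop)
  ...   | inj₂ pair′ = ⊥-elim (Cyclicity.clawFree⇒¬claw G free (twoNonCocyclic⇒claw qn≡ cop pair pair′))
  ...   | inj₁ (g , gn , generates) = p , P , cyclicOrder g gn generates , cyclicOrder≢0 g gn generates
          , p-prime
          -- The order of `P` divides a power of `p ^ v`, hence a power of `p`.
          , ∣-prime-power (v * k) p-prime (subst (order P ∣_) (^-*-assoc p v k) order∣)
          -- A cyclic `P` would give the images of `a` and `b` a common root, which lifts to `G`.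
          , (λ P-cyclic → let a , b , _ , _ , ¬ab = pair in
               ¬ab (φ⇒cocyclic a b (Cyclicity.isCyclic⇒cocyclic P P-cyclic a b)))
          , decompose g gn generates
          , coprime⇒gcd≡1 P-cop
          , Cyclicity.¬claw⇒clawFree P (Cyclicity.clawFree⇒¬claw G free ∘ φ⇒claw)
    where
    open Decomposition G nilpotent qn≡ cop
    P = torsionGroup
    k = proj₁ torsionGroup-order
    order∣ = proj₂ torsionGroup-order

    P-cop : Coprime (order P) (cyclicOrder g gn generates)
    P-cop (d∣P , d∣o) = coprime-^ˡ k cop
      (∣-trans d∣P order∣ , ∣-trans d∣o (cyclicOrder∣n g gn generates))

    open CyclicFactor G P (cyclicOrder g gn generates) {{cyclicOrder≢0 g gn generates}}
      P-cop (decompose g gn generates)
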